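{- Let $s\ge k_1\ge2$ and $\Gamma=\Gamma_{k_1,k_1,s}=\Gamma_{k_1,k_1}\cup\{12\cdots s(s+1)\}$. Then $U_{\Gamma,1}(y)=-y$ and for $n\ge2$ $$U_{\Gamma,n}(y)=-y\sum_{r=1}^{k_1-1}U_{\Gamma,n-r}(y)-y\sum_{p=0}^{s-k_1}\left[\left(1+\binom{n-p-2}{k_1-1}\right)U_{\Gamma,n-p-k_1}(y)+y\binom{n-p-2}{k_1-1}\sum_{a=1}^{k_1-1}U_{\Gamma,n-p-k_1-a}(y)\right].$$
   Context: $\Gamma_{k_1,k_2}=\{\sigma\in\mathfrak S_{k_1+k_2}:\sigma_1=1,\ \sigma_{k_1+1}=2,\ \sigma_1<\cdots<\sigma_{k_1},\ \sigma_{k_1+1}<\cdots<\sigma_{k_1+k_2}\}$, and $12\cdots s(s+1)$ is the identity of $\mathfrak S_{s+1}$. For $\sigma\in\mathfrak S_n$, $\mathrm{des}(\sigma)$ is the number of $i$ with $\sigma_i>\sigma_{i+1}$. For distinct integers $\alpha=\alpha_1\cdots\alpha_r$, $\mathrm{red}(\alpha)\in\mathfrak S_r$ replaces the $i$-th smallest entry by $i$. $\sigma$ has a $\Gamma$-match starting at position $i$ if there is $j\ge1$ with $\mathrm{red}(\sigma_i\cdots\sigma_{i+j})\in\Gamma$; $\mathcal{NM}_n(\Gamma)$ is the set of $\sigma\in\mathfrak S_n$ with no $\Gamma$-match. The polynomials $U_{\Gamma,n}(y)$ are defined by $\sum_{n\ge0}U_{\Gamma,n}(y)\frac{t^n}{n!}=\left(1+\sum_{n\ge1}\frac{t^n}{n!}\sum_{\sigma\in\mathcal{NM}_n(\Gamma)}y^{1+\mathrm{des}(\sigma)}\right)^{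 -1}$; in particular $U_{\Gamma,0}=1$, and $U_{\Gamma,j}=0$ for $j<0$. Binomial coefficients $\binom{a}{b}$ are $0$ when $a<b$. -}

module Defs where

open import Data.Bool using (Bool; true; false; _∧_; _∨_; not; if_then_else_)
open import Data.Nat using (ℕ; zero; suc; _+_; _∸_; _<ᵇ_; _≡ᵇ_)
open import Data.Nat.Combinatorics using (_C_)
open import Data.Integer as ℤ using (ℤ; +_; -[1+_])
open import Data.List using (List; []; _∷_; [_]; map; concatMap; length; take; drop; upTo; zipWith)
open import Data.Nat.ListAction using (sum)
open import Data.Bool.ListAction using (all; any)
open import Relation.Binary.PropositionalEquality using (_≡_)

-- Words (permutations written in one-line notation as lists of ℕ)

nth0 : List ℕ → ℕ → ℕ
nth0 [] _ = 0
nth0 (x ∷ xs) zero = x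
nth0 (x ∷ xs) (suc i) = nth0 xs i

countEq : ℕ → List ℕ → ℕ
countEq v xs = sum (map (λ x → if x ≡ᵇ v then 1 else 0) xs)

eqList : List ℕ → List ℕ → Bool
eqList [] [] = true
eqList (x ∷ xs) (y ∷ ys) = (x ≡ᵇ y) ∧ eqList xs ys
eqList _ _ = false

isPermB : List ℕ → Bool
isPermB τ = all (λ i → countEq (suc i) τ ≡ᵇ 1) (upTo (length τ))

incr : List ℕ → Bool
incr [] = true
incr (x ∷ []) = true
incr (x ∷ y ∷ ys) = (x <ᵇ y) ∧ incr (y ∷ ys)

red : List ℕ → List ℕ
red α = map (λ a → suc (sum (map (λ b → if b <ᵇ a then 1 else 0) α))) α

des : List ℕ → ℕ
des σ = sum (zipWith (λ a b → if b <ᵇ a then 1 else 0) σ (drop 1 σ))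

insertAll : ℕ → List ℕ → List (List ℕ)
insertAll x [] = [ x ∷ [] ]
insertAll x (y ∷ ys) = (x ∷ y ∷ ys) ∷ map (y ∷_) (insertAll x ys)

perms : ℕ → List (List ℕ)
perms zero = [ [] ]
perms (suc n) = concatMap (insertAll (suc n)) (perms n)

inΓk : ℕ → ℕ → List ℕ → Bool
inΓk k1 k2 τ = (length τ ≡ᵇ (k1 + k2)) ∧ isPermB τ
             ∧ (nth0 τ 0 ≡ᵇ 1) ∧ (nth0 τ k1 ≡ᵇ 2)
             ∧ incr (take k1 τ) ∧ incr (drop k1 τ)

idPerm : ℕ → List ℕ
idPerm m = map suc (upTo m)

inΓ : ℕ → ℕ → List ℕ → Bool
inΓ k1 s τ = inΓk k1 k1 τ ∨ eqList τ (idPerm (suc s))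

matchAt : ℕ → ℕ → List ℕ → ℕ → Bool
matchAt k1 s σ i =
  any (λ j → inΓ k1 s (red (take (suc j) (drop i σ))))
      (map suc (upTo (length σ ∸ suc i)))

hasMatch : ℕ → ℕ → List ℕ → Bool
hasMatch k1 s σ = any (matchAt k1 s σ) (upTo (length σ))

-- Polynomials in y with integer coefficients, as coefficient sequences

Poly : Set
Poly = ℕ → ℤ

_≈ᴾ_ : Poly → Poly → Set
p ≈ᴾ q = ∀ d → p d ≡ q d

0ᴾ 1ᴾ yᴾ : Poly
0ᴾ _ = + 0
1ᴾ zero = + 1
1ᴾ (suc _) = + 0
yᴾ (suc zero) = + 1
yᴾ _ = + 0

_+ᴾ_ : Poly → Poly → Poly
(p +ᴾ q) d = p d ℤ.+ q d

-ᴾ_ : Poly → Poly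
(-ᴾ p) d = ℤ.- p d

sumℤ : List ℤ → ℤ
sumℤ [] = + 0
sumℤ (x ∷ xs) = x ℤ.+ sumℤ xs

_*ᴾ_ : Poly → Poly → Poly
(p *ᴾ q) d = sumℤ (map (λ i → p i ℤ.* q (d ∸ i)) (upTo (suc d)))

infixl 6 _+ᴾ_
infixl 7 _*ᴾ_

-- Σ_{i=lo}^{hi} f i  (empty if hi < lo)
Σᴾ[_to_] : ℕ → ℕ → (ℕ → Poly) → Poly
Σᴾ[ lo to hi ] f d = sumℤ (map (λ i → f (lo + i) d) (upTo (suc hi ∸ lo)))

A : ℕ → ℕ → ℕ → Poly
A k1 s k d = + sum (map (λ σ → if not (hasMatch k1 s σ) ∧ (suc (des σ) ≡ᵇ d) then 1 else 0) (perms k))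

-- The EGF identity  (Σ_{n≥0} U_n tⁿ/n!)·(1 + Σ_{n≥1} A_n tⁿ/n!) = 1
-- is equivalent to U_0 = 1 and, for n ≥ 1,
--   U_n = - Σ_{k=1}^{n} C(n,k) A_k U_{n-k}.
-- table n = [U_n, U_{n-1}, …, U_0]

nthᴾ : List Poly → ℕ → Poly
nthᴾ [] _ = 0ᴾ
nthᴾ (p ∷ ps) zero = p
nthᴾ (p ∷ ps) (suc i) = nthᴾ ps i

table : ℕ → ℕ → ℕ → List Poly
table k1 s zero = 1ᴾ ∷ []
table k1 s (suc n) = new ∷ prev
  where
  prev = table k1 s n
  new = -ᴾ Σᴾ[ 1 to suc n ] (λ k d → (+ (suc n C k)) ℤ.* (A k1 s k *ᴾ nthᴾ prev (k ∸ 1)) d)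

U : ℕ → ℕ → ℕ → Poly
U k1 s n = nthᴾ (table k1 s n) 0

Uz : ℕ → ℕ → ℤ → Poly
Uz k1 s (+ n) = U k1 s n
Uz k1 s -[1+ _ ] = 0ᴾ

-- binomial coefficient with integer top; 0 when a < b (in particular a < 0)
binomZ : ℤ → ℕ → ℕ
binomZ (+ a) b = a C b
binomZ -[1+ _ ] b = 0

_·ᴾ_ : ℤ → Poly → Poly
(c ·ᴾ p) d = c ℤ.* p d
infixl 7 _·ᴾ_

{-# OPTIONS --safe #-}
module Submission where

-- Call a factorisation of a word into increasing bricks of length at most s a tiling if at every boundary either the
-- letters ascend, or the last k₁ letters of the left brick and the first k₁ letters of the right brick form a pattern
-- in Γ_{k₁,k₁}; weight a tiling by (-y)^{number of bricks}.
--
-- For a fixed nonempty word, the sum over all its splittings into a Γ-avoiding prefix u, weighted by y^{1 + des u}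
-- (by 1 if u is empty), and a tiled suffix vanishes: moving the first brick to the end of the prefix, or the last
-- increasing run of the prefix back, is a sign-reversing involution, because a pattern in Γ has at most one descent.
-- Summing over permutations shows that U_n is the weighted number of tiled permutations of size n.
--
-- In a tiled permutation 1 comes first, and 2 is either the second letter or the first letter of the second brick,
-- the first brick then having length exactly k₁.  Removing 1 in the former case, and the whole first brick (chosen in
-- C(n - 2, k₁ - 1) ways) in the latter, gives the recurrence by the length of the first brick.

open import Defs
open import Data.Bool using (Bool; true; false; _∧_; _∨_; not; if_then_else_; T)
open import Data.Bool.ListAction using (any; all; or)
open import Data.Bool.Properties using (T-≡; T-∧; T-∨; ∧-assoc; ∧-comm; ∧-zeroʳ)
open import Data.Empty using (⊥-elim)
open import Data.Nat using (ℕ; zero; suc; _≤_; _<_; _∸_; _+_; _<ᵇ_; _≡ᵇ_; z≤n; s≤s)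
open import Data.Nat.Combinatorics using (_C_; nCn≡1; nCk+nC[k+1]≡[n+1]C[k+1]; k>n⇒nCk≡0)
open import Data.Nat.ListAction using (sum)
import Data.Nat.Properties as ℕₚ
open import Data.Integer as ℤ using (ℤ; +_; -[1+_]; _-_)
import Data.Integer.Properties as ℤₚ
open import Data.Integer.Tactic.RingSolver using (solve-∀)
open import Data.List using (List; []; _∷_; _∷ʳ_; map; _++_; length; take; drop; reverse; upTo; applyUpTo; concatMap)
import Data.List.Properties as Lₚ
open import Data.List.Membership.Propositional using (_∈_)
open import Data.List.Membership.Propositional.Properties using (∈-map⁺; ∈-map⁻; ∈-upTo⁺; ∈-upTo⁻; ∈-++⁺ˡ; ∈-++⁺ʳ)
open import Data.List.Relation.Binary.Permutation.Propositional using (_↭_; ↭-refl; ↭-sym; ↭-trans; prep; swap; ↭⇒↭ₛ)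
open import Data.List.Relation.Binary.Permutation.Propositional.Properties using (∈-resp-↭; All-resp-↭; ↭-length; ↭-reverse)
open import Data.List.Relation.Binary.Permutation.Setoid.Properties using (Unique-resp-↭)
open import Data.List.Relation.Binary.Subset.Propositional using (_⊆_)
open import Data.List.Relation.Unary.All as All using (All; []; _∷_)
import Data.List.Relation.Unary.All.Properties as Allₚ
open import Data.List.Relation.Unary.AllPairs using ([]; _∷_)
open import Data.List.Relation.Unary.Any using (here; there)
open import Data.List.Relation.Unary.Unique.Propositional using (Unique)
import Data.List.Relation.Unary.Unique.Propositional.Properties as Uniqueₚ
open import Data.Product using (_×_; _,_; proj₁; proj₂; ∃)
open import Data.Sum using (_⊎_; inj₁; inj₂)
open import Data.Unit using (⊤; tt)
open import Function using (_∘_; id)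
open import Function.Bundles using (Equivalence)
open import Relation.Binary.Definitions using (tri<; tri≈; tri>)
open import Relation.Binary.PropositionalEquality
open import Relation.Nullary using (¬_; yes; no)
open Equivalence using (to; from)

-- The rule at descents is dictated by the cancellation. Avoidance restricts the last increasing run
-- of a prefix only through its length: it is at most `s`, but less than `k` if the `k` letters
-- before it increase and its first letter lies between the first two of them. In the latter case a
-- brick of length from `k` to `s` cannot be moved into the prefix, and exactly these bricks stay
-- uncancelled; tilings allow them there, so the same bookkeeping works at every descent. Before an
-- empty prefix there is no such window, hence nothing is left over. The second factor `y` in the
-- recurrence comes from complementation. What remains after deleting a whole first brick must begin
-- with a brick of length at least `k`; its weight is that of all tiled permutations minus that of
-- those with a shorter first brick, and the sign of a brick turns the subtraction into `+ y`. Two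
-- constructions have to be bridged: `perms` inserts maxima, whereas the recurrence deletes minima.
-- Hence every summand is shown to depend on relative order only.

Word : Set
Word = List ℕ

<ᵇ-true : ∀ {a b} → a < b → (a <ᵇ b) ≡ true
<ᵇ-true a<b = to T-≡ (ℕₚ.<⇒<ᵇ a<b)

<ᵇ-false : ∀ {a b} → b ≤ a → (a <ᵇ b) ≡ false
<ᵇ-false {a} {b} b≤a with a <ᵇ b in eq
... | false = refl
... | true = ⊥-elim (ℕₚ.<⇒≱ (ℕₚ.<ᵇ⇒< a b (from T-≡ eq)) b≤a)

interchange : ∀ a b c d → a ℤ.+ b ℤ.+ (c ℤ.+ d) ≡ a ℤ.+ c ℤ.+ (b ℤ.+ d)
interchange = solve-∀

-- Sums over the insertions of a letter into a word

ins : ℕ → Word → (Word → ℤ) → ℤ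
ins x [] f = f (x ∷ [])
ins x (y ∷ ys) f = f (x ∷ y ∷ ys) ℤ.+ ins x ys (f ∘ (y ∷_))

ins-cong : ∀ x w {f g} → (∀ v → v ↭ x ∷ w → f v ≡ g v) → ins x w f ≡ ins x w g
ins-cong x [] f≗g = f≗g _ ↭-refl
ins-cong x (y ∷ ys) f≗g =
  cong₂ ℤ._+_ (f≗g _ ↭-refl)
    (ins-cong x ys λ v v↭ → f≗g (y ∷ v) (↭-trans (prep y v↭) (swap y x ↭-refl)))

ins-+ : ∀ x w f g → ins x w (λ v → f v ℤ.+ g v) ≡ ins x w f ℤ.+ ins x w g
ins-+ x [] f g = refl
ins-+ x (y ∷ ys) f g =
  trans (cong (ℤ._+_ (f (x ∷ y ∷ ys) ℤ.+ g (x ∷ y ∷ ys))) (ins-+ x ys (f ∘ (y ∷_)) (g ∘ (y ∷_))))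
        (interchange (f (x ∷ y ∷ ys)) (g (x ∷ y ∷ ys)) (ins x ys (f ∘ (y ∷_))) (ins x ys (g ∘ (y ∷_))))

ins-* : ∀ c x w f → ins x w (λ v → c ℤ.* f v) ≡ c ℤ.* ins x w f
ins-* c x [] f = refl
ins-* c x (y ∷ ys) f =
  trans (cong (ℤ._+_ (c ℤ.* f (x ∷ y ∷ ys))) (ins-* c x ys (f ∘ (y ∷_))))
        (sym (ℤₚ.*-distribˡ-+ c _ _))

ins-zero : ∀ x w {f} → (∀ v → v ↭ x ∷ w → f v ≡ + 0) → ins x w f ≡ + 0
ins-zero x w {f} f≡0 =
  trans (ins-cong x w {g = λ v → + 0 ℤ.* f v} (λ v p → trans (f≡0 v p) (sym (ℤₚ.*-zeroˡ (f v)))))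
        (trans (ins-* (+ 0) x w f) (ℤₚ.*-zeroˡ (ins x w f)))

ins-map-suc : ∀ x w f → ins (suc x) (map suc w) f ≡ ins x w (f ∘ map suc)
ins-map-suc x [] f = refl
ins-map-suc x (y ∷ ys) f = cong (ℤ._+_ (f (suc x ∷ suc y ∷ map suc ys))) (ins-map-suc x ys (f ∘ (suc y ∷_)))

ins-comm : ∀ x y w f → ins x w (λ v → ins y v f) ≡ ins y w (λ v → ins x v f)
ins-comm x y [] f = ℤₚ.+-comm (f (y ∷ x ∷ [])) _
ins-comm x y (a ∷ w) f = begin
  f (y ∷ x ∷ a ∷ w) ℤ.+ (f (x ∷ y ∷ a ∷ w) ℤ.+ Bʸ) ℤ.+ ins x w (λ v → f (y ∷ a ∷ v) ℤ.+ ins y v (f ∘ (a ∷_)))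
    ≡⟨ cong (ℤ._+_ (f (y ∷ x ∷ a ∷ w) ℤ.+ (f (x ∷ y ∷ a ∷ w) ℤ.+ Bʸ))) (ins-+ x w _ _) ⟩
  f (y ∷ x ∷ a ∷ w) ℤ.+ (f (x ∷ y ∷ a ∷ w) ℤ.+ Bʸ) ℤ.+ (Bˣ ℤ.+ ins x w (λ v → ins y v (f ∘ (a ∷_))))
    ≡⟨ cong (λ e → f (y ∷ x ∷ a ∷ w) ℤ.+ (f (x ∷ y ∷ a ∷ w) ℤ.+ Bʸ) ℤ.+ (Bˣ ℤ.+ e)) (ins-comm x y w (f ∘ (a ∷_))) ⟩
  f (y ∷ x ∷ a ∷ w) ℤ.+ (f (x ∷ y ∷ a ∷ w) ℤ.+ Bʸ) ℤ.+ (Bˣ ℤ.+ E)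
    ≡⟨ shuffle (f (y ∷ x ∷ a ∷ w)) (f (x ∷ y ∷ a ∷ w)) Bʸ Bˣ E ⟩
  f (x ∷ y ∷ a ∷ w) ℤ.+ (f (y ∷ x ∷ a ∷ w) ℤ.+ Bˣ) ℤ.+ (Bʸ ℤ.+ E)
    ≡⟨ cong (ℤ._+_ (f (x ∷ y ∷ a ∷ w) ℤ.+ (f (y ∷ x ∷ a ∷ w) ℤ.+ Bˣ))) (ins-+ y w _ _) ⟨
  f (x ∷ y ∷ a ∷ w) ℤ.+ (f (y ∷ x ∷ a ∷ w) ℤ.+ Bˣ) ℤ.+ ins y w (λ v → f (x ∷ a ∷ v) ℤ.+ ins x v (f ∘ (a ∷_)))
    ∎
  where
  open ≡-Reasoning
  Bʸ = ins y w (f ∘ (x ∷_) ∘ (a ∷_))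
  Bˣ = ins x w (f ∘ (y ∷_) ∘ (a ∷_))
  E = ins y w (λ v → ins x v (f ∘ (a ∷_)))
  shuffle : ∀ p q b c e → p ℤ.+ (q ℤ.+ b) ℤ.+ (c ℤ.+ e) ≡ q ℤ.+ (p ℤ.+ c) ℤ.+ (b ℤ.+ e)
  shuffle = solve-∀

-- A pair of order-isomorphic words is represented by their zip.

Iso : List (ℕ × ℕ) → Set
Iso z = ∀ {p q} → p ∈ z → q ∈ z → (proj₁ p <ᵇ proj₁ q) ≡ (proj₂ p <ᵇ proj₂ q)

Inv : ∀ {X : Set} → (Word → X) → Set
Inv f = ∀ z → Iso z → f (map proj₁ z) ≡ f (map proj₂ z)

Iso-⊆ : ∀ {z z′} → (∀ {p} → p ∈ z′ → p ∈ z) → Iso z → Iso z′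
Iso-⊆ ⊆ iso p∈ q∈ = iso (⊆ p∈) (⊆ q∈)

map-zip : ∀ (g h : ℕ → ℕ) w → map proj₁ (map (λ a → g a , h a) w) ≡ map g w × map proj₂ (map (λ a → g a , h a) w) ≡ map h w
map-zip g h w = sym (Lₚ.map-∘ w) , sym (Lₚ.map-∘ w)

Iso-zip : ∀ (g h : ℕ → ℕ) → (∀ a b → (g a <ᵇ g b) ≡ (h a <ᵇ h b)) → ∀ w → Iso (map (λ a → g a , h a) w)
Iso-zip g h gh w p∈ q∈ with ∈-map⁻ _ p∈ | ∈-map⁻ _ q∈
... | a , _ , refl | b , _ , refl = gh a b

Inv-map-suc : ∀ {X : Set} (f : Word → X) → Inv f → ∀ w → f (map suc w) ≡ f w
Inv-map-suc f inv w = begin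
  f (map suc w)           ≡⟨ cong f (proj₁ (map-zip suc id w)) ⟨
  f (map proj₁ z)         ≡⟨ inv z (Iso-zip suc id (λ _ _ → refl) w) ⟩
  f (map proj₂ z)         ≡⟨ cong f (proj₂ (map-zip suc id w)) ⟩
  f (map id w)            ≡⟨ cong f (Lₚ.map-id w) ⟩
  f w                     ∎
  where
  open ≡-Reasoning
  z = map (λ a → suc a , a) w

length-proj : ∀ (z : List (ℕ × ℕ)) → length (map proj₁ z) ≡ length (map proj₂ z)
length-proj z = trans (Lₚ.length-map proj₁ z) (sym (Lₚ.length-map proj₂ z))

ins-Iso : ∀ p z {f g} → (∀ z′ → z′ ↭ p ∷ z → f (map proj₁ z′) ≡ g (map proj₂ z′)) →
          ins (proj₁ p) (map proj₁ z) f ≡ ins (proj₂ p) (map proj₂ z) g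
ins-Iso p [] fg = fg _ ↭-refl
ins-Iso p (q ∷ z) fg =
  cong₂ ℤ._+_ (fg _ ↭-refl)
    (ins-Iso p z λ z′ z′↭ → fg (q ∷ z′) (↭-trans (prep q z′↭) (swap q p ↭-refl)))

insMin : (Word → ℤ) → Word → ℤ
insMin f w = ins 0 (map suc w) f

suc² : ℕ × ℕ → ℕ × ℕ
suc² (a , b) = suc a , suc b

Iso-min : ∀ z → Iso z → Iso ((0 , 0) ∷ map suc² z)
Iso-min z iso (here refl) (here refl) = refl
Iso-min z iso (here refl) (there q∈) with ∈-map⁻ suc² q∈
... | _ , _ , refl = refl
Iso-min z iso (there p∈) (here refl) with ∈-map⁻ suc² p∈
... | _ , _ , refl = refl
Iso-min z iso (there p∈) (there q∈) with ∈-map⁻ suc² p∈ | ∈-map⁻ suc² q∈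
... | _ , p∈′ , refl | _ , q∈′ , refl = iso p∈′ q∈′

map-suc² : ∀ z → map proj₁ (map suc² z) ≡ map suc (map proj₁ z) × map proj₂ (map suc² z) ≡ map suc (map proj₂ z)
map-suc² z = trans (sym (Lₚ.map-∘ z)) (Lₚ.map-∘ z) , trans (sym (Lₚ.map-∘ z)) (Lₚ.map-∘ z)

Inv-insMin : ∀ {f} → Inv f → Inv (insMin f)
Inv-insMin {f} inv z iso = begin
  ins 0 (map suc (map proj₁ z)) f ≡⟨ cong (λ w → ins 0 w f) (proj₁ (map-suc² z)) ⟨
  ins 0 (map proj₁ (map suc² z)) f
    ≡⟨ ins-Iso (0 , 0) (map suc² z) (λ z′ z′↭ → inv z′ (Iso-⊆ (∈-resp-↭ z′↭) (Iso-min z iso))) ⟩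
  ins 0 (map proj₂ (map suc² z)) f ≡⟨ cong (λ w → ins 0 w f) (proj₂ (map-suc² z)) ⟩
  ins 0 (map suc (map proj₂ z)) f ∎
  where open ≡-Reasoning

ins-max-Iso : ∀ {f} → Inv f → ∀ {M N} z → Iso z → (∀ {p} → p ∈ z → proj₁ p < M × proj₂ p < N) →
              ins M (map proj₁ z) f ≡ ins N (map proj₂ z) f
ins-max-Iso inv {M} {N} z iso bnd =
  ins-Iso (M , N) z (λ z′ z′↭ → inv z′ (Iso-⊆ (∈-resp-↭ z′↭) iso′))
  where
  iso′ : Iso ((M , N) ∷ z)
  iso′ (here refl) (here refl) = trans (<ᵇ-false {M} ℕₚ.≤-refl) (sym (<ᵇ-false {N} ℕₚ.≤-refl))
  iso′ (here refl) (there q∈) =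
    trans (<ᵇ-false (ℕₚ.<⇒≤ (proj₁ (bnd q∈)))) (sym (<ᵇ-false (ℕₚ.<⇒≤ (proj₂ (bnd q∈)))))
  iso′ (there p∈) (here refl) = trans (<ᵇ-true (proj₁ (bnd p∈))) (sym (<ᵇ-true (proj₂ (bnd p∈))))
  iso′ (there p∈) (there q∈) = iso p∈ q∈

-- An order-invariant function sees only that the new letter exceeds the others. This exchanges the
-- letter `suc n` used by `perms` for the canonical choice `bound w`.
ins-max : ∀ {f} → Inv f → ∀ {M N} w → All (_< M) w → All (_< N) w → ins M w f ≡ ins N w f
ins-max {f} inv {M} {N} w w<M w<N = begin
  ins M w f               ≡⟨ cong (λ v → ins M v f) (trans (proj₁ (map-zip id id w)) (Lₚ.map-id w)) ⟨
  ins M (map proj₁ z) f   ≡⟨ ins-max-Iso inv z (Iso-zip id id (λ _ _ → refl) w) bnd ⟩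
  ins N (map proj₂ z) f   ≡⟨ cong (λ v → ins N v f) (trans (proj₂ (map-zip id id w)) (Lₚ.map-id w)) ⟩
  ins N w f               ∎
  where
  open ≡-Reasoning
  z = map (λ a → a , a) w
  bnd : ∀ {p} → p ∈ z → proj₁ p < M × proj₂ p < N
  bnd p∈ with ∈-map⁻ _ p∈
  ... | a , a∈ , refl = All.lookup w<M a∈ , All.lookup w<N a∈

-- Any letter above all of `w` would serve; the sum plus one is the cheapest to bound.
bound : Word → ℕ
bound w = suc (sum w)

<-bound : ∀ {w a} → a ∈ w → a < bound w
<-bound {x ∷ w} (here refl) = s≤s (ℕₚ.m≤m+n x (sum w))
<-bound {x ∷ w} (there a∈) = ℕₚ.≤-trans (<-bound a∈) (s≤s (ℕₚ.m≤n+m (sum w) x))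

insMax : (Word → ℤ) → Word → ℤ
insMax f w = ins (bound w) w f

∈-map-proj₁ : ∀ {z : List (ℕ × ℕ)} {p} → p ∈ z → proj₁ p ∈ map proj₁ z
∈-map-proj₁ (here refl) = here refl
∈-map-proj₁ (there p∈) = there (∈-map-proj₁ p∈)

∈-map-proj₂ : ∀ {z : List (ℕ × ℕ)} {p} → p ∈ z → proj₂ p ∈ map proj₂ z
∈-map-proj₂ (here refl) = here refl
∈-map-proj₂ (there p∈) = there (∈-map-proj₂ p∈)

Inv-insMax : ∀ {f} → Inv f → Inv (insMax f)
Inv-insMax inv z iso =
  ins-max-Iso inv z iso (λ p∈ → <-bound (∈-map-proj₁ p∈) , <-bound (∈-map-proj₂ p∈))

-- The two insertions commute by `ins-comm` once they use fixed letters. Since `bound` changes when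
-- the word is shifted and receives `0`, it is first replaced by `suc (bound w)`.
insMin-insMax : ∀ {f} → Inv f → ∀ w → insMin (insMax f) w ≡ insMax (insMin f) w
insMin-insMax {f} inv w = begin
  ins 0 (map suc w) (λ v → ins (bound v) v f)
    ≡⟨ ins-cong 0 (map suc w) (λ v v↭ → ins-max inv v (All.tabulate <-bound) (All-resp-↭ (↭-sym v↭) v<)) ⟩
  ins 0 (map suc w) (λ v → ins (suc (bound w)) v f)
    ≡⟨ ins-comm 0 (suc (bound w)) (map suc w) f ⟩
  ins (suc (bound w)) (map suc w) (λ v → ins 0 v f)
    ≡⟨ ins-map-suc (bound w) w _ ⟩
  ins (bound w) w (insMin f) ∎
  where
  open ≡-Reasoning
  v< : All (_< suc (bound w)) (0 ∷ map suc w)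
  v< = s≤s z≤n ∷ Allₚ.map⁺ (All.tabulate (λ a∈ → s≤s (<-bound a∈)))

-- Sums over permutations, built by inserting a new minimum

∑ : ℕ → (Word → ℤ) → ℤ
∑ zero f = f []
∑ (suc n) f = ∑ n (insMin f)

∑-cong : ∀ n {f g} → (∀ w → length w ≡ n → Unique w → f w ≡ g w) → ∑ n f ≡ ∑ n g
∑-cong zero f≗g = f≗g [] refl []
∑-cong (suc n) f≗g = ∑-cong n λ w |w| uw → ins-cong 0 (map suc w) λ v v↭ →
  f≗g v (trans (↭-length v↭) (cong suc (trans (Lₚ.length-map suc w) |w|)))
        (Unique-resp-↭ (setoid ℕ) (↭⇒↭ₛ (↭-sym v↭))
           (Allₚ.map⁺ (All.universal (λ _ ()) w) ∷ Uniqueₚ.map⁺ ℕₚ.suc-injective uw))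

∑-ext : ∀ n {f g} → (∀ w → f w ≡ g w) → ∑ n f ≡ ∑ n g
∑-ext n f≗g = ∑-cong n (λ w _ _ → f≗g w)

∑-+ : ∀ n f g → ∑ n (λ w → f w ℤ.+ g w) ≡ ∑ n f ℤ.+ ∑ n g
∑-+ zero f g = refl
∑-+ (suc n) f g = trans (∑-ext n (λ w → ins-+ 0 (map suc w) f g)) (∑-+ n _ _)

∑-* : ∀ c n f → ∑ n (λ w → c ℤ.* f w) ≡ c ℤ.* ∑ n f
∑-* c zero f = refl
∑-* c (suc n) f = trans (∑-ext n (λ w → ins-* c 0 (map suc w) f)) (∑-* c n _)

∑-zero : ∀ n {f} → (∀ w → length w ≡ n → Unique w → f w ≡ + 0) → ∑ n f ≡ + 0
∑-zero n {f} f≡0 =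
  trans (∑-cong n {g = λ w → + 0 ℤ.* f w} (λ w l u → trans (f≡0 w l u) (sym (ℤₚ.*-zeroˡ (f w)))))
        (trans (∑-* (+ 0) n f) (ℤₚ.*-zeroˡ (∑ n f)))

∑-neg : ∀ n f → ∑ n (λ w → ℤ.- f w) ≡ ℤ.- ∑ n f
∑-neg n f = trans (∑-ext n (λ w → sym (ℤₚ.-1*i≡-i (f w)))) (trans (∑-* ℤ.-1ℤ n f) (ℤₚ.-1*i≡-i _))

∑-sumℤ : ∀ {I : Set} n (f : I → Word → ℤ) is → ∑ n (λ w → sumℤ (map (λ i → f i w) is)) ≡ sumℤ (map (λ i → ∑ n (f i)) is)
∑-sumℤ n f [] = ∑-zero n (λ _ _ _ → refl)
∑-sumℤ n f (i ∷ is) = trans (∑-+ n (f i) (λ w → sumℤ (map (λ i → f i w) is))) (cong (ℤ._+_ (∑ n (f i))) (∑-sumℤ n f is))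

-- `∑` peels off minima, so the maximum is carried past them one at a time; order invariance
-- identifies the one-letter words `1` and `0` at the end.
∑-insMax : ∀ n {f} → Inv f → ∑ n (insMax f) ≡ ∑ (suc n) f
∑-insMax zero inv = inv ((1 , 0) ∷ []) λ { (here refl) (here refl) → refl }
∑-insMax (suc n) {f} inv =
  trans (∑-ext n (insMin-insMax inv)) (∑-insMax n (Inv-insMin inv))

-- Mirrors the recursion of `perms`; it serves only as a bridge to `∑`.
∑ᵐ : ℕ → (Word → ℤ) → ℤ
∑ᵐ zero f = f []
∑ᵐ (suc n) f = ∑ᵐ n (λ w → ins (suc n) w f)

∑ᵐ-cong : ∀ n {f g} → (∀ w → All (_≤ n) w → f w ≡ g w) → ∑ᵐ n f ≡ ∑ᵐ n g
∑ᵐ-cong zero f≗g = f≗g [] []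
∑ᵐ-cong (suc n) f≗g = ∑ᵐ-cong n λ w w≤ → ins-cong (suc n) w λ v v↭ →
  f≗g v (All-resp-↭ (↭-sym v↭) (ℕₚ.≤-refl ∷ All.map ℕₚ.m≤n⇒m≤1+n w≤))

∑ᵐ≡∑ : ∀ n {f} → Inv f → ∑ᵐ n f ≡ ∑ n f
∑ᵐ≡∑ zero inv = refl
∑ᵐ≡∑ (suc n) inv =
  trans (∑ᵐ-cong n (λ w w≤ → ins-max inv w (All.map s≤s w≤) (All.tabulate <-bound)))
        (trans (∑ᵐ≡∑ n (Inv-insMax inv)) (∑-insMax n inv))

sumℤ-++ : ∀ xs ys → sumℤ (xs ++ ys) ≡ sumℤ xs ℤ.+ sumℤ ys
sumℤ-++ [] ys = sym (ℤₚ.+-identityˡ _)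
sumℤ-++ (x ∷ xs) ys = trans (cong (ℤ._+_ x) (sumℤ-++ xs ys)) (sym (ℤₚ.+-assoc x _ _))

sumℤ-insertAll : ∀ x w f → sumℤ (map f (insertAll x w)) ≡ ins x w f
sumℤ-insertAll x [] f = ℤₚ.+-identityʳ _
sumℤ-insertAll x (y ∷ ys) f =
  cong (ℤ._+_ (f (x ∷ y ∷ ys))) (trans (cong sumℤ (sym (Lₚ.map-∘ {g = f} {f = y ∷_} (insertAll x ys)))) (sumℤ-insertAll x ys (f ∘ (y ∷_))))

sumℤ-concatMap : ∀ {X Y : Set} (f : Y → ℤ) (g : X → List Y) xs →
                 sumℤ (map f (concatMap g xs)) ≡ sumℤ (map (λ x → sumℤ (map f (g x))) xs)
sumℤ-concatMap f g [] = refl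
sumℤ-concatMap f g (x ∷ xs) =
  trans (cong sumℤ (Lₚ.map-++ f (g x) _))
        (trans (sumℤ-++ (map f (g x)) _) (cong (ℤ._+_ (sumℤ (map f (g x)))) (sumℤ-concatMap f g xs)))

sumℤ-perms : ∀ n f → sumℤ (map f (perms n)) ≡ ∑ᵐ n f
sumℤ-perms zero f = ℤₚ.+-identityʳ _
sumℤ-perms (suc n) f =
  trans (sumℤ-concatMap f (insertAll (suc n)) (perms n))
        (trans (cong sumℤ (Lₚ.map-cong (λ w → sumℤ-insertAll (suc n) w f) (perms n)))
               (sumℤ-perms n _))

sum-perms : ∀ n (f : Word → ℕ) → Inv f → + sum (map f (perms n)) ≡ ∑ n (+_ ∘ f)
sum-perms n f inv = trans (+-sum (perms n)) (trans (sumℤ-perms n _) (∑ᵐ≡∑ n (λ z iso → cong +_ (inv z iso))))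
  where
  +-sum : ∀ ws → + sum (map f ws) ≡ sumℤ (map (+_ ∘ f) ws)
  +-sum [] = refl
  +-sum (w ∷ ws) = cong (ℤ._+_ (+ f w)) (+-sum ws)

-- Splitting a permutation into a prefix and a suffix

split : ℕ → (Word → Word → ℤ) → Word → ℤ
split i h w = h (take i w) (drop i w)

ins-split : ∀ x i w h → suc i ≤ length w →
  ins x w (split (suc i) h) ≡
  ins x (take i w) (λ u → h u (drop i w)) ℤ.+ ins x (drop (suc i) w) (λ v → h (take (suc i) w) v)
ins-split x zero (y ∷ w) h _ = refl
ins-split x (suc i) (y ∷ w) h (s≤s i<) =
  trans (cong (ℤ._+_ (h (x ∷ y ∷ take i w) (drop i w))) (ins-split x i w (λ u v → h (y ∷ u) v) i<))
        (sym (ℤₚ.+-assoc (h (x ∷ y ∷ take i w) (drop i w)) _ _))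

-- Pascal's rule: the new minimum falls to the left (`h₁`) or to the right (`h₂`) of the cut. The
-- case of an empty suffix is separate because `ins-split` needs a letter on the right.
∑-split : ∀ i j h → (∀ v → Inv (λ u → h u v)) → (∀ u → Inv (h u)) →
  ∑ (i + j) (split i h) ≡ + ((i + j) C i) ℤ.* ∑ i (λ u → ∑ j (h u))
∑-split zero j h invˡ invʳ = sym (ℤₚ.*-identityˡ _)
∑-split (suc i) zero h invˡ invʳ = begin
  ∑ (suc (i + 0)) (split (suc i) h)   ≡⟨ cong (λ n → ∑ (suc n) (split (suc i) h)) (ℕₚ.+-identityʳ i) ⟩
  ∑ (suc i) (split (suc i) h)
    ≡⟨ ∑-cong (suc i) (λ w |w| _ → cong₂ h (Lₚ.take-all (suc i) w (ℕₚ.≤-reflexive |w|))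
                                             (Lₚ.drop-all (suc i) w (ℕₚ.≤-reflexive |w|))) ⟩
  ∑ (suc i) (λ u → h u [])            ≡⟨ ℤₚ.*-identityˡ _ ⟨
  + 1 ℤ.* ∑ (suc i) (λ u → h u [])    ≡⟨ cong (λ c → + c ℤ.* ∑ (suc i) (λ u → h u [])) C≡1 ⟨
  + (suc (i + 0) C suc i) ℤ.* ∑ (suc i) (λ u → h u []) ∎
  where
  open ≡-Reasoning
  C≡1 : suc (i + 0) C suc i ≡ 1
  C≡1 = trans (cong (λ n → suc n C suc i) (ℕₚ.+-identityʳ i)) (nCn≡1 (suc i))
∑-split (suc i) (suc j) h invˡ invʳ = begin
  ∑ (i + suc j) (insMin (split (suc i) h))
    ≡⟨ ∑-cong (i + suc j) (λ w |w| _ → step w |w|) ⟩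
  ∑ (i + suc j) (λ w → split i h₁ w ℤ.+ split (suc i) h₂ w)
    ≡⟨ ∑-+ (i + suc j) _ _ ⟩
  ∑ (i + suc j) (split i h₁) ℤ.+ ∑ (i + suc j) (split (suc i) h₂)
    ≡⟨ cong₂ ℤ._+_ (∑-split i (suc j) h₁ (λ v → Inv-insMin (invˡ v)) inv₁ʳ)
         (trans (cong (λ n → ∑ n (split (suc i) h₂)) (ℕₚ.+-suc i j))
                (∑-split (suc i) j h₂ inv₂ˡ (λ u → Inv-insMin (invʳ u)))) ⟩
  + ((i + suc j) C i) ℤ.* ∑ i (λ u → ∑ (suc j) (h₁ u)) ℤ.+ + (suc (i + j) C suc i) ℤ.* X
    ≡⟨ cong₂ (λ e n → + ((i + suc j) C i) ℤ.* e ℤ.+ + (n C suc i) ℤ.* X) ∑h₁ (sym (ℕₚ.+-suc i j)) ⟩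
  + ((i + suc j) C i) ℤ.* X ℤ.+ + ((i + suc j) C suc i) ℤ.* X
    ≡⟨ ℤₚ.*-distribʳ-+ X (+ ((i + suc j) C i)) (+ ((i + suc j) C suc i)) ⟨
  + ((i + suc j) C i + (i + suc j) C suc i) ℤ.* X
    ≡⟨ cong (λ c → + c ℤ.* X) (nCk+nC[k+1]≡[n+1]C[k+1] (i + suc j) i) ⟩
  + (suc (i + suc j) C suc i) ℤ.* X ∎
  where
  open ≡-Reasoning
  X = ∑ (suc i) (λ u → ∑ (suc j) (h u))
  h₁ h₂ : Word → Word → ℤ
  h₁ u v = insMin (λ u′ → h u′ v) u
  h₂ u v = insMin (h u) v
  inv₁ʳ : ∀ u → Inv (h₁ u)
  inv₁ʳ u z iso = ins-cong 0 (map suc u) (λ u′ _ → invʳ u′ z iso)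
  inv₂ˡ : ∀ v → Inv (λ u → h₂ u v)
  inv₂ˡ v z iso = ins-cong 0 (map suc v) (λ v′ _ → invˡ v′ z iso)
  ∑-ins : ∀ x w n (f : Word → Word → ℤ) → ∑ n (λ v → ins x w (λ u → f u v)) ≡ ins x w (λ u → ∑ n (f u))
  ∑-ins x [] n f = refl
  ∑-ins x (y ∷ w) n f = trans (∑-+ n (f (x ∷ y ∷ w)) (λ v → ins x w (λ u → f (y ∷ u) v)))
          (cong (ℤ._+_ (∑ n (f (x ∷ y ∷ w)))) (∑-ins x w n (λ u v → f (y ∷ u) v)))
  ∑h₁ : ∑ i (λ u → ∑ (suc j) (h₁ u)) ≡ X
  ∑h₁ = ∑-ext i (λ u → ∑-ins 0 (map suc u) (suc j) h)
  step : ∀ w → length w ≡ i + suc j → insMin (split (suc i) h) w ≡ split i h₁ w ℤ.+ split (suc i) h₂ w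
  step w |w| = begin
    ins 0 (map suc w) (split (suc i) h)
      ≡⟨ ins-split 0 i (map suc w) h (ℕₚ.≤-trans (ℕₚ.≤-trans (s≤s (ℕₚ.m≤m+n i j)) (ℕₚ.≤-reflexive (sym (ℕₚ.+-suc i j))))
           (ℕₚ.≤-reflexive (sym (trans (Lₚ.length-map suc w) |w|)))) ⟩
    ins 0 (take i (map suc w)) (λ u → h u (drop i (map suc w))) ℤ.+ ins 0 (drop (suc i) (map suc w)) (h (take (suc i) (map suc w)))
      ≡⟨ cong₂ ℤ._+_
           (trans (cong₂ (λ a b → ins 0 a (λ u → h u b)) (Lₚ.take-map i w) (Lₚ.drop-map i w))
                  (ins-cong 0 (map suc (take i w)) (λ u _ → Inv-map-suc (h u) (invʳ u) (drop i w))))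
           (trans (cong₂ (λ a b → ins 0 a (h b)) (Lₚ.drop-map (suc i) w) (Lₚ.take-map (suc i) w))
                  (ins-cong 0 (map suc (drop (suc i) w)) (λ v _ → Inv-map-suc (λ u → h u v) (invˡ v) (take (suc i) w)))) ⟩
    split i h₁ w ℤ.+ split (suc i) h₂ w ∎

T⇒true : ∀ {b} → T b → b ≡ true
T⇒true = to T-≡

T-⇔⇒≡ : ∀ {a b} → (T a → T b) → (T b → T a) → a ≡ b
T-⇔⇒≡ {false} {false} f g = refl
T-⇔⇒≡ {false} {true} f g = ⊥-elim (g tt)
T-⇔⇒≡ {true} {false} f g = ⊥-elim (f tt)
T-⇔⇒≡ {true} {true} f g = refl

-- Ranks of letters in a word

below : ℕ → Word → ℕ
below a w = sum (map (λ b → if b <ᵇ a then 1 else 0) w)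

𝟙-mono : ∀ {a b} → a ≤ b → ∀ c → (if c <ᵇ a then 1 else 0) ≤ (if c <ᵇ b then 1 else 0)
𝟙-mono {a} {b} a≤b c with c <ᵇ a in eq
... | false = z≤n
... | true rewrite <ᵇ-true (ℕₚ.<-≤-trans (ℕₚ.<ᵇ⇒< c a (from T-≡ eq)) a≤b) = s≤s z≤n

below-mono : ∀ {a b} → a ≤ b → ∀ w → below a w ≤ below b w
below-mono a≤b [] = z≤n
below-mono a≤b (c ∷ w) = ℕₚ.+-mono-≤ (𝟙-mono a≤b c) (below-mono a≤b w)

below-strict : ∀ {a b w} → a < b → a ∈ w → below a w < below b w
below-strict {a} {b} {c ∷ w} a<b (here refl)
  rewrite <ᵇ-false {a} ℕₚ.≤-refl | <ᵇ-true a<b = s≤s (below-mono (ℕₚ.<⇒≤ a<b) w)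
below-strict {a} {b} {c ∷ w} a<b (there a∈) =
  ℕₚ.+-mono-≤-< (𝟙-mono (ℕₚ.<⇒≤ a<b) c) (below-strict a<b a∈)

below≤length : ∀ a w → below a w ≤ length w
below≤length a [] = z≤n
below≤length a (c ∷ w) = ℕₚ.+-mono-≤ (𝟙≤1 (c <ᵇ a)) (below≤length a w)
  where
  𝟙≤1 : ∀ b → (if b then 1 else 0) ≤ 1
  𝟙≤1 false = z≤n
  𝟙≤1 true = s≤s z≤n

below-zero : ∀ {a w} → All (a ≤_) w → below a w ≡ 0
below-zero [] = refl
below-zero (a≤ ∷ aw) rewrite <ᵇ-false a≤ = below-zero aw

rank-<ᵇ : ∀ {a w} → a ∈ w → ∀ b → (suc (below a w) <ᵇ suc (below b w)) ≡ (a <ᵇ b)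
rank-<ᵇ {a} {w} a∈ b with ℕₚ.<-cmp a b
... | tri< a<b _ _ rewrite <ᵇ-true a<b = <ᵇ-true (below-strict a<b a∈)
... | tri≈ _ refl _ rewrite <ᵇ-false {a} ℕₚ.≤-refl = <ᵇ-false {below a w} ℕₚ.≤-refl
... | tri> _ _ b<a rewrite <ᵇ-false (ℕₚ.<⇒≤ b<a) = <ᵇ-false (below-mono (ℕₚ.<⇒≤ b<a) w)

incr-rank : ∀ w u → All (_∈ w) u → incr (map (λ a → suc (below a w)) u) ≡ incr u
incr-rank w [] [] = refl
incr-rank w (a ∷ []) _ = refl
incr-rank w (a ∷ b ∷ u) (a∈ ∷ ps) = cong₂ _∧_ (rank-<ᵇ a∈ b) (incr-rank w (b ∷ u) ps)

incr-red : ∀ w → incr (red w) ≡ incr w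
incr-red w = incr-rank w w (All.tabulate id)

incr-head : ∀ {x} w → T (incr (x ∷ w)) → All (x <_) w
incr-head [] _ = []
incr-head {x} (y ∷ w) p with to (T-∧ {x <ᵇ y}) p
... | x<ᵇy , q = x<y ∷ All.map (ℕₚ.<-trans x<y) (incr-head w q)
  where x<y = ℕₚ.<ᵇ⇒< x y x<ᵇy

incr-tail : ∀ {x} w → T (incr (x ∷ w)) → T (incr w)
incr-tail [] _ = tt
incr-tail {x} (y ∷ w) p = proj₂ (to (T-∧ {x <ᵇ y}) p)

rankCount : ℕ → Word → Word → ℕ
rankCount i w u = sum (map (λ a → if below a w ≡ᵇ i then 1 else 0) u)

≡ᵇ-true : ∀ n → (n ≡ᵇ n) ≡ true
≡ᵇ-true n = T⇒true (ℕₚ.≡⇒≡ᵇ n n refl)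

≡ᵇ-false : ∀ {m n} → m ≢ n → (m ≡ᵇ n) ≡ false
≡ᵇ-false {m} {n} m≢n with m ≡ᵇ n in eq
... | false = refl
... | true = ⊥-elim (m≢n (ℕₚ.≡ᵇ⇒≡ m n (from T-≡ eq)))

rankCount-cong : ∀ {i i′ w w′} u → All (λ a → (below a w ≡ᵇ i) ≡ (below a w′ ≡ᵇ i′)) u →
                 rankCount i w u ≡ rankCount i′ w′ u
rankCount-cong [] [] = refl
rankCount-cong {i} {i′} {w} {w′} (a ∷ u) (p ∷ ps) =
  cong₂ (λ b n → (if b then 1 else 0) + n) p (rankCount-cong {i} {i′} {w} {w′} u ps)

rankCount-zero : ∀ {i w} u → All (λ a → below a w ≢ i) u → rankCount i w u ≡ 0
rankCount-zero [] [] = refl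
rankCount-zero {i} {w} (a ∷ u) (p ∷ ps) rewrite ≡ᵇ-false p = rankCount-zero {i} {w} u ps

-- Putting `x` in front raises by one the ranks of exactly the letters above `x`. So the letter of
-- rank `i` had rank `i` before, or is `x` itself, or had rank `i - 1`, according to how `i`
-- compares with the rank of `x`.
rankCount≡1 : ∀ w → Unique w → ∀ i → i < length w → rankCount i w w ≡ 1
rankCount≡1 (x ∷ w) (x∉ ∷ uw) i i< with ℕₚ.<-cmp i (below x w)
... | tri< i<r i≢r _
  rewrite <ᵇ-false {x} ℕₚ.≤-refl | ≡ᵇ-false (≢-sym i≢r) =
  trans (rankCount-cong {i} {i} {x ∷ w} {w} w (All.tabulate same))
        (rankCount≡1 w uw i (ℕₚ.<-≤-trans i<r (below≤length x w)))
  where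
  same : ∀ {a} → a ∈ w → (below a (x ∷ w) ≡ᵇ i) ≡ (below a w ≡ᵇ i)
  same {a} a∈ with x <ᵇ a in eq
  ... | false = refl
  ... | true = trans (≡ᵇ-false (≢-sym (ℕₚ.<⇒≢ (ℕₚ.<-trans i<b (ℕₚ.n<1+n _))))) (sym (≡ᵇ-false (≢-sym (ℕₚ.<⇒≢ i<b))))
    where i<b = ℕₚ.<-≤-trans i<r (below-mono (ℕₚ.<⇒≤ (ℕₚ.<ᵇ⇒< x a (from T-≡ eq))) w)
... | tri≈ _ refl _
  rewrite <ᵇ-false {x} ℕₚ.≤-refl | ≡ᵇ-true (below x w) =
  cong suc (rankCount-zero {below x w} {x ∷ w} w (All.tabulate differ))
  where
  differ : ∀ {a} → a ∈ w → below a (x ∷ w) ≢ below x w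
  differ {a} a∈ with ℕₚ.<-cmp x a
  ... | tri< x<a _ _ rewrite <ᵇ-true x<a = ≢-sym (ℕₚ.<⇒≢ (s≤s (below-mono (ℕₚ.<⇒≤ x<a) w)))
  ... | tri≈ _ refl _ = ⊥-elim (All.lookup x∉ a∈ refl)
  ... | tri> _ _ a<x rewrite <ᵇ-false (ℕₚ.<⇒≤ a<x) = ℕₚ.<⇒≢ (below-strict {w = w} a<x a∈)
rankCount≡1 (x ∷ w) (x∉ ∷ uw) (suc i) (s≤s i<) | tri> _ i≢r (s≤s r≤i)
  rewrite <ᵇ-false {x} ℕₚ.≤-refl | ≡ᵇ-false (≢-sym i≢r) =
  trans (rankCount-cong {suc i} {i} {x ∷ w} {w} w (All.tabulate shift)) (rankCount≡1 w uw i i<)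
  where
  shift : ∀ {a} → a ∈ w → (below a (x ∷ w) ≡ᵇ suc i) ≡ (below a w ≡ᵇ i)
  shift {a} a∈ with ℕₚ.<-cmp x a
  ... | tri< x<a _ _ rewrite <ᵇ-true x<a = refl
  ... | tri≈ _ refl _ = ⊥-elim (All.lookup x∉ a∈ refl)
  ... | tri> _ _ a<x rewrite <ᵇ-false (ℕₚ.<⇒≤ a<x) =
    trans (≡ᵇ-false (ℕₚ.<⇒≢ (ℕₚ.<-trans b<i (ℕₚ.n<1+n i)))) (sym (≡ᵇ-false (ℕₚ.<⇒≢ b<i)))
    where b<i = ℕₚ.<-≤-trans (below-strict {w = w} a<x a∈) r≤i

isPermB-red : ∀ w → Unique w → T (isPermB (red w))
isPermB-red w uw = all⁺ (upTo (length (red w))) λ i∈ →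
  subst (λ n → T (n ≡ᵇ 1)) (sym (trans (cong sum (sym (Lₚ.map-∘ w)))
    (rankCount≡1 w uw _ (subst (_ <_) (Lₚ.length-map _ w) (∈-upTo⁻ i∈))))) tt
  where
  all⁺ : ∀ {p : ℕ → Bool} is → (∀ {i} → i ∈ is → T (p i)) → T (all p is)
  all⁺ [] f = tt
  all⁺ {p} (i ∷ is) f = from (T-∧ {p i}) (f (here refl) , all⁺ is (f ∘ there))

red-incr : ∀ w → T (incr w) → red w ≡ idPerm (length w)
red-incr [] _ = refl
red-incr (x ∷ w) p = cong₂ _∷_ (cong suc head≡0) (begin
  map (λ a → suc (below a (x ∷ w))) w    ≡⟨ Lₚ.map-cong-local (All.map shift (incr-head w p)) ⟩
  map (λ a → suc (suc (below a w))) w    ≡⟨ Lₚ.map-∘ w ⟩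
  map suc (red w)                        ≡⟨ cong (map suc) (red-incr w (incr-tail w p)) ⟩
  map suc (map suc (upTo (length w)))    ≡⟨ cong (map suc) (Lₚ.map-upTo suc (length w)) ⟩
  map suc (applyUpTo suc (length w)) ∎)
  where
  open ≡-Reasoning
  head≡0 : below x (x ∷ w) ≡ 0
  head≡0 = below-zero {x} (ℕₚ.≤-refl ∷ All.map ℕₚ.<⇒≤ (incr-head w p))
  shift : ∀ {a} → x < a → suc (below a (x ∷ w)) ≡ suc (suc (below a w))
  shift x<a rewrite <ᵇ-true x<a = refl

incr-idPerm : ∀ n → T (incr (idPerm n))
incr-idPerm n = subst (T ∘ incr) (sym (Lₚ.map-upTo suc n)) (go suc (λ _ → ℕₚ.n<1+n _) n)
  where
  go : ∀ f → (∀ i → f i < f (suc i)) → ∀ n → T (incr (applyUpTo f n))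
  go f f< zero = tt
  go f f< (suc zero) = tt
  go f f< (suc (suc n)) = from (T-∧ {f 0 <ᵇ f 1}) (ℕₚ.<⇒<ᵇ (f< 0) , go (f ∘ suc) (f< ∘ suc) (suc n))

length-idPerm : ∀ n → length (idPerm n) ≡ n
length-idPerm n = trans (Lₚ.length-map suc (upTo n)) (Lₚ.length-upTo n)

eqList⇒≡ : ∀ u v → T (eqList u v) → u ≡ v
eqList⇒≡ [] [] _ = refl
eqList⇒≡ (x ∷ u) (y ∷ v) p with to (T-∧ {x ≡ᵇ y}) p
... | q , r = cong₂ _∷_ (ℕₚ.≡ᵇ⇒≡ x y q) (eqList⇒≡ u v r)

eqList-refl : ∀ u → T (eqList u u)
eqList-refl [] = tt
eqList-refl (x ∷ u) = from (T-∧ {x ≡ᵇ x}) (ℕₚ.≡⇒≡ᵇ x x refl , eqList-refl u)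

take-≡ : ∀ {X : Set} {n} (u v : List X) → length u ≡ n → take n (u ++ v) ≡ u
take-≡ [] v refl = refl
take-≡ (x ∷ u) v refl = cong (x ∷_) (take-≡ u v refl)

drop-≡ : ∀ {X : Set} {n} (u v : List X) → length u ≡ n → drop n (u ++ v) ≡ v
drop-≡ [] v refl = refl
drop-≡ (x ∷ u) v refl = drop-≡ u v refl

nth0-≡ : ∀ {n} u x v → length u ≡ n → nth0 (u ++ x ∷ v) n ≡ x
nth0-≡ [] x v refl = refl
nth0-≡ (_ ∷ u) x v refl = nth0-≡ u x v refl

-- Patterns of Γ as comparisons between letters

module Matches (j s : ℕ) where

  k : ℕ
  k = suc (suc j)

  -- For two increasing halves, having the values 1 and 2 at their heads amounts to `u₀ < v₀ < u₁`.
  -- In this form no ranks are needed, and the condition can be tested while reading letters.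
  record Form (w : Word) : Set where
    constructor form
    field
      u₀ u₁ : ℕ
      u : Word
      v₀ : ℕ
      v : Word
      w≡ : w ≡ (u₀ ∷ u₁ ∷ u) ++ v₀ ∷ v
      |u| : length u ≡ j
      |v| : length v ≡ suc j
      incr-u : T (incr (u₀ ∷ u₁ ∷ u))
      incr-v : T (incr (v₀ ∷ v))
      u₀<v₀ : u₀ < v₀
      v₀<u₁ : v₀ < u₁

  Match : Word → Set
  Match w = Form w ⊎ (length w ≡ suc s × T (incr w))

  split-at : ∀ m n (w : Word) → length w ≡ m + n → ∃ λ u → ∃ λ v → w ≡ u ++ v × length u ≡ m × length v ≡ n
  split-at zero n w p = [] , w , refl , refl , p
  split-at (suc m) n (x ∷ w) p with split-at m n w (ℕₚ.suc-injective p)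
  ... | u , v , refl , q , r = x ∷ u , v , refl , cong suc q , r

  rank : Word → ℕ → ℕ
  rank w a = suc (below a w)

  Γk⇒Form : ∀ w → Unique w → T (inΓk k k (red w)) → Form w
  Γk⇒Form w uw p with to (T-∧ {length (red w) ≡ᵇ (k + k)}) p
  ... | p₁ , p₂₋ with to (T-∧ {isPermB (red w)}) p₂₋
  ... | _ , p₃₋ with to (T-∧ {nth0 (red w) 0 ≡ᵇ 1}) p₃₋
  ... | p₃ , p₄₋ with to (T-∧ {nth0 (red w) k ≡ᵇ 2}) p₄₋
  ... | p₄ , p₅₋ with to (T-∧ {incr (take k (red w))}) p₅₋
  ... | p₅ , p₆ with split-at k k w (trans (sym (Lₚ.length-map _ w)) (ℕₚ.≡ᵇ⇒≡ _ (k + k) p₁))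
  ... | u₀ ∷ u₁ ∷ u , v₀ ∷ v , refl , |u| , |v| =
    form u₀ u₁ u v₀ v refl (ℕₚ.suc-injective (ℕₚ.suc-injective |u|)) (ℕₚ.suc-injective |v|) iu iv u₀<v₀ v₀<u₁
    where
    U′ = u₀ ∷ u₁ ∷ u
    V′ = v₀ ∷ v
    W′ = U′ ++ V′
    red≡ : red W′ ≡ map (rank W′) U′ ++ map (rank W′) V′
    red≡ = Lₚ.map-++ (rank W′) U′ V′
    |rU| : length (map (rank W′) U′) ≡ k
    |rU| = trans (Lₚ.length-map (rank W′) U′) |u|
    iu : T (incr U′)
    iu = subst T (trans (cong incr (trans (cong (take k) red≡) (take-≡ (map (rank W′) U′) _ |rU|)))
           (incr-rank W′ U′ (All.tabulate ∈-++⁺ˡ))) p₅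
    iv : T (incr V′)
    iv = subst T (trans (cong incr (trans (cong (drop k) red≡) (drop-≡ (map (rank W′) U′) _ |rU|)))
           (incr-rank W′ V′ (All.tabulate (∈-++⁺ʳ U′)))) p₆
    b₀ : below u₀ W′ ≡ 0
    b₀ = ℕₚ.suc-injective (ℕₚ.≡ᵇ⇒≡ (rank W′ u₀) 1 p₃)
    b₁ : below v₀ W′ ≡ 1
    b₁ = ℕₚ.suc-injective (trans (sym (trans (cong (λ r → nth0 r k) red≡) (nth0-≡ (map (rank W′) U′) _ _ |rU|)))
           (ℕₚ.≡ᵇ⇒≡ (nth0 (red W′) k) 2 p₄))
    u₀<v₀ : u₀ < v₀
    u₀<v₀ = ℕₚ.<ᵇ⇒< u₀ v₀ (subst T (trans (sym (cong₂ (λ a b → suc a <ᵇ suc b) b₀ b₁)) (rank-<ᵇ {w = W′} (here refl) v₀)) tt)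
    v₀<u₁ : v₀ < u₁
    v₀<u₁ with ℕₚ.<-cmp u₁ v₀
    ... | tri> _ _ p = p
    ... | tri≈ _ eq _ = ⊥-elim (u₁≢v₀ uw eq)
      where
      u₁≢v₀ : Unique W′ → u₁ ≢ v₀
      u₁≢v₀ (_ ∷ (u₁∉ ∷ _)) = All.lookup u₁∉ (∈-++⁺ʳ u (here refl))
    -- Otherwise `u₀ < u₁ < v₀`, and `v₀` would have rank at least 3.
    ... | tri< u₁<v₀ _ _ = ⊥-elim (ℕₚ.<⇒≱
      (subst₂ _<_ b₀ refl (below-strict {w = W′} (ℕₚ.<ᵇ⇒< u₀ u₁ (proj₁ (to (T-∧ {u₀ <ᵇ u₁}) iu))) (here refl)))
      (ℕₚ.≤-pred (subst (below u₁ W′ <_) b₁ (below-strict {w = W′} u₁<v₀ (there (here refl))))))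

  Form⇒Γk : ∀ w → Unique w → Form w → T (inΓk k k (red w))
  Form⇒Γk w uw (form u₀ u₁ u v₀ v refl |u| |v| iu iv u₀<v₀ v₀<u₁) =
    from (T-∧ {length (red w) ≡ᵇ (k + k)}) (ℕₚ.≡⇒≡ᵇ _ (k + k) len ,
    from (T-∧ {isPermB (red w)}) (isPermB-red w uw ,
    from (T-∧ {nth0 (red w) 0 ≡ᵇ 1}) (ℕₚ.≡⇒≡ᵇ (nth0 (red w) 0) 1 (cong suc b₀) ,
    from (T-∧ {nth0 (red w) k ≡ᵇ 2}) (ℕₚ.≡⇒≡ᵇ (nth0 (red w) k) 2
        (trans (cong (λ r → nth0 r k) red≡) (trans (nth0-≡ (map (rank w) U′) _ _ |rU|) (cong suc b₁))) ,
    from (T-∧ {incr (take k (red w))})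
      ( subst T (sym (trans (cong incr (trans (cong (take k) red≡) (take-≡ (map (rank w) U′) _ |rU|)))
           (incr-rank w U′ (All.tabulate ∈-++⁺ˡ)))) iu
      , subst T (sym (trans (cong incr (trans (cong (drop k) red≡) (drop-≡ (map (rank w) U′) _ |rU|)))
           (incr-rank w V′ (All.tabulate (∈-++⁺ʳ U′))))) iv)))))
    where
    U′ = u₀ ∷ u₁ ∷ u
    V′ = v₀ ∷ v
    red≡ : red w ≡ map (rank w) U′ ++ map (rank w) V′
    red≡ = Lₚ.map-++ (rank w) U′ V′
    |U| : length U′ ≡ k
    |U| = cong (suc ∘ suc) |u|
    |rU| : length (map (rank w) U′) ≡ k
    |rU| = trans (Lₚ.length-map (rank w) U′) |U|
    len : length (red w) ≡ k + k
    len = trans (Lₚ.length-map (rank w) w) (trans (Lₚ.length-++ U′) (cong₂ _+_ |U| (cong suc |v|)))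
    v≥ : All (v₀ ≤_) V′
    v≥ = ℕₚ.≤-refl ∷ All.map ℕₚ.<⇒≤ (incr-head v iv)
    b₀ : below u₀ w ≡ 0
    b₀ = below-zero {w = w} (ℕₚ.≤-refl ∷ Allₚ.++⁺ (All.map ℕₚ.<⇒≤ (incr-head (u₁ ∷ u) iu))
           (All.map (ℕₚ.≤-trans (ℕₚ.<⇒≤ u₀<v₀)) v≥))
    b₁ : below v₀ w ≡ 1
    b₁ rewrite <ᵇ-true u₀<v₀ = cong suc (below-zero {w = u₁ ∷ u ++ V′} (ℕₚ.<⇒≤ v₀<u₁ ∷ Allₚ.++⁺
           (All.map (λ u₁< → ℕₚ.<⇒≤ (ℕₚ.<-trans v₀<u₁ u₁<)) (incr-head u (incr-tail (u₁ ∷ u) iu))) v≥))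

  Γ⇒Match : ∀ w → Unique w → T (inΓ k s (red w)) → Match w
  Γ⇒Match w uw p with to (T-∨ {inΓk k k (red w)}) p
  ... | inj₁ q = inj₁ (Γk⇒Form w uw q)
  ... | inj₂ q = inj₂ (trans (sym (Lₚ.length-map _ w)) (trans (cong length red≡) (length-idPerm (suc s))) ,
                       subst T (trans (cong incr (sym red≡)) (incr-red w)) (incr-idPerm (suc s)))
    where
    red≡ : red w ≡ idPerm (suc s)
    red≡ = eqList⇒≡ _ _ q

  Match⇒Γ : ∀ w → Unique w → Match w → T (inΓ k s (red w))
  Match⇒Γ w uw (inj₁ f) = from (T-∨ {inΓk k k (red w)}) (inj₁ (Form⇒Γk w uw f))
  Match⇒Γ w uw (inj₂ (|w| , iw)) = from (T-∨ {inΓk k k (red w)}) (inj₂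
    (subst (λ r → T (eqList r (idPerm (suc s)))) (sym (trans (red-incr w iw) (cong idPerm |w|))) (eqList-refl (idPerm (suc s)))))

any⁻ : ∀ {X : Set} {p : X → Bool} xs → T (any p xs) → ∃ λ x → x ∈ xs × T (p x)
any⁻ {p = p} (x ∷ xs) q with to (T-∨ {p x}) q
... | inj₁ px = x , here refl , px
... | inj₂ q′ with any⁻ xs q′
... | y , y∈ , py = y , there y∈ , py

any⁺ : ∀ {X : Set} {p : X → Bool} {xs} x → x ∈ xs → T (p x) → T (any p xs)
any⁺ {p = p} x (here refl) px = from (T-∨ {p x}) (inj₁ px)
any⁺ {p = p} {y ∷ _} x (there x∈) px = from (T-∨ {p y}) (inj₂ (any⁺ x x∈ px))

-- Increasing words read backwards

decr : Word → Bool
decr [] = true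
decr (x ∷ []) = true
decr (x ∷ y ∷ w) = (y <ᵇ x) ∧ decr (y ∷ w)

∧-left-comm : ∀ a b c → a ∧ b ∧ c ≡ b ∧ a ∧ c
∧-left-comm a b c = trans (sym (∧-assoc a b c)) (trans (cong (_∧ c) (∧-comm a b)) (∧-assoc b a c))

incr-∷ʳ : ∀ w x y → incr (w ++ x ∷ y ∷ []) ≡ (x <ᵇ y) ∧ incr (w ++ x ∷ [])
incr-∷ʳ [] x y = refl
incr-∷ʳ (a ∷ []) x y = ∧-left-comm (a <ᵇ x) (x <ᵇ y) true
incr-∷ʳ (a ∷ b ∷ w) x y rewrite incr-∷ʳ (b ∷ w) x y = ∧-left-comm (a <ᵇ b) (x <ᵇ y) _

decr≡incr : ∀ w → decr w ≡ incr (reverse w)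
decr≡incr [] = refl
decr≡incr (x ∷ []) = refl
decr≡incr (x ∷ y ∷ w) = begin
  (y <ᵇ x) ∧ decr (y ∷ w)            ≡⟨ cong ((y <ᵇ x) ∧_) (decr≡incr (y ∷ w)) ⟩
  (y <ᵇ x) ∧ incr (reverse (y ∷ w))  ≡⟨ cong (λ v → (y <ᵇ x) ∧ incr v) (Lₚ.unfold-reverse y w) ⟩
  (y <ᵇ x) ∧ incr (reverse w ∷ʳ y)   ≡⟨ incr-∷ʳ (reverse w) y x ⟨
  incr (reverse w ++ y ∷ x ∷ [])     ≡⟨ cong incr (Lₚ.++-assoc (reverse w) (y ∷ []) (x ∷ [])) ⟨
  incr ((reverse w ∷ʳ y) ∷ʳ x)       ≡⟨ cong (λ v → incr (v ∷ʳ x)) (Lₚ.unfold-reverse y w) ⟨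
  incr (reverse (y ∷ w) ∷ʳ x)        ≡⟨ cong incr (Lₚ.unfold-reverse x (y ∷ w)) ⟨
  incr (reverse (x ∷ y ∷ w))         ∎
  where open ≡-Reasoning

decr-reverse : ∀ w → decr (reverse w) ≡ incr w
decr-reverse w = trans (decr≡incr (reverse w)) (cong incr (Lₚ.reverse-involutive w))

Unique-factor : ∀ (u v w : Word) → Unique (u ++ v ++ w) → Unique v
Unique-factor (x ∷ u) v w (_ ∷ p) = Unique-factor u v w p
Unique-factor [] v w p = prefix v p
  where
  prefix : ∀ v → Unique (v ++ w) → Unique v
  prefix [] _ = []
  prefix (x ∷ v) (x∉ ∷ p) = Allₚ.++⁻ˡ v x∉ ∷ prefix v p

Unique-reverse : ∀ (w : Word) → Unique w → Unique (reverse w)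
Unique-reverse w = Unique-resp-↭ (setoid ℕ) (↭⇒↭ₛ (↭-sym (↭-reverse w)))

-- Avoidance tested letter by letter

module Endings (j s : ℕ) (k≤s : suc (suc j) ≤ s) where
  open Matches j s

  -- Words are read backwards in this module: the head of a list is the last letter of the word.

  -- The last m + 1 letters increase.
  dec : ℕ → Word → Bool
  dec m [] = false
  dec zero (c ∷ r) = true
  dec (suc m) (c ∷ []) = false
  dec (suc m) (c ∷ c′ ∷ r) = (c′ <ᵇ c) ∧ dec m (c′ ∷ r)

  -- The word ends with an increasing run u₀ < u₁ < ⋯ of length i + 2 such that u₀ < x < u₁.
  win : ℕ → Word → ℕ → Bool
  win i [] x = false
  win i (c ∷ []) x = false
  win zero (c ∷ c′ ∷ r) x = (x <ᵇ c) ∧ (c′ <ᵇ x)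
  win (suc i) (c ∷ c′ ∷ r) x = (c′ <ᵇ c) ∧ win i (c′ ∷ r) x

  -- The last `m + 1` letters increase, and the first of them is the `x` of a window of `k` letters
  -- just before it. For `m = suc j` this is an occurrence of Γ_{k,k} at the end of the word.
  endΓ : ℕ → Word → Bool
  endΓ m [] = false
  endΓ zero (c ∷ r) = win j r c
  endΓ (suc m) (c ∷ []) = false
  endΓ (suc m) (c ∷ c′ ∷ r) = (c′ <ᵇ c) ∧ endΓ m (c′ ∷ r)

  ending : Word → Bool
  ending r = dec s r ∨ endΓ (suc j) r

  -- Each match is charged to its last letter, so that appending a letter costs a single new test.
  -- This makes an induction along the last run possible.
  avoids : Word → Bool
  avoids [] = true
  avoids (c ∷ r) = avoids r ∧ not (ending (c ∷ r))

  dec⁻ : ∀ m r → T (dec m r) → ∃ λ g → ∃ λ r′ → r ≡ g ++ r′ × length g ≡ suc m × T (decr g)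
  dec⁻ zero (c ∷ r) _ = c ∷ [] , r , refl , refl , tt
  dec⁻ (suc m) (c ∷ c′ ∷ r) p with to (T-∧ {c′ <ᵇ c}) p
  ... | c′<c , q with dec⁻ m (c′ ∷ r) q
  ... | _ ∷ g , r′ , refl , |g| , d = c ∷ c′ ∷ g , r′ , refl , cong suc |g| , from (T-∧ {c′ <ᵇ c}) (c′<c , d)

  dec⁺ : ∀ m g r → length g ≡ suc m → T (decr g) → T (dec m (g ++ r))
  dec⁺ zero (c ∷ g) r _ _ = tt
  dec⁺ (suc m) (c ∷ c′ ∷ g) r |g| d with to (T-∧ {c′ <ᵇ c}) d
  ... | c′<c , d′ = from (T-∧ {c′ <ᵇ c}) (c′<c , dec⁺ m (c′ ∷ g) r (ℕₚ.suc-injective |g|) d′)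
  dec⁺ (suc m) (c ∷ []) r () _

  win⁻ : ∀ i r x → T (win i r x) → ∃ λ u → ∃ λ u₁ → ∃ λ u₀ → ∃ λ r′ →
         r ≡ u ++ u₁ ∷ u₀ ∷ r′ × length u ≡ i × T (decr (u ++ u₁ ∷ u₀ ∷ [])) × u₀ < x × x < u₁
  win⁻ zero (c ∷ c′ ∷ r) x p with to (T-∧ {x <ᵇ c}) p
  ... | x<c , c′<x = [] , c , c′ , r , refl , refl ,
    from (T-∧ {c′ <ᵇ c}) (ℕₚ.<⇒<ᵇ (ℕₚ.<-trans (ℕₚ.<ᵇ⇒< c′ x c′<x) (ℕₚ.<ᵇ⇒< x c x<c)) , tt) ,
    ℕₚ.<ᵇ⇒< c′ x c′<x , ℕₚ.<ᵇ⇒< x c x<c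
  win⁻ (suc i) (c ∷ c′ ∷ r) x p with to (T-∧ {c′ <ᵇ c}) p
  ... | c′<c , q with win⁻ i (c′ ∷ r) x q
  ... | [] , u₁ , u₀ , r′ , refl , |u| , d , lo , hi =
    c ∷ [] , u₁ , u₀ , r′ , refl , cong suc |u| , from (T-∧ {c′ <ᵇ c}) (c′<c , d) , lo , hi
  ... | _ ∷ u , u₁ , u₀ , r′ , refl , |u| , d , lo , hi =
    c ∷ c′ ∷ u , u₁ , u₀ , r′ , refl , cong suc |u| , from (T-∧ {c′ <ᵇ c}) (c′<c , d) , lo , hi

  win⁺ : ∀ i u u₁ u₀ r x → length u ≡ i → T (decr (u ++ u₁ ∷ u₀ ∷ [])) → u₀ < x → x < u₁ →
         T (win i (u ++ u₁ ∷ u₀ ∷ r) x)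
  win⁺ zero [] u₁ u₀ r x _ d lo hi = from (T-∧ {x <ᵇ u₁}) (ℕₚ.<⇒<ᵇ hi , ℕₚ.<⇒<ᵇ lo)
  win⁺ (suc i) (c ∷ []) u₁ u₀ r x |u| d lo hi with to (T-∧ {u₁ <ᵇ c}) d
  ... | lt , d′ = from (T-∧ {u₁ <ᵇ c}) (lt , win⁺ i [] u₁ u₀ r x (ℕₚ.suc-injective |u|) d′ lo hi)
  win⁺ (suc i) (c ∷ c′ ∷ u) u₁ u₀ r x |u| d lo hi with to (T-∧ {c′ <ᵇ c}) d
  ... | lt , d′ = from (T-∧ {c′ <ᵇ c}) (lt , win⁺ i (c′ ∷ u) u₁ u₀ r x (ℕₚ.suc-injective |u|) d′ lo hi)

  endΓ⁻ : ∀ m r → T (endΓ m r) → ∃ λ v → ∃ λ v₀ → ∃ λ r′ →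
          r ≡ v ++ v₀ ∷ r′ × length v ≡ m × T (decr (v ++ v₀ ∷ [])) × T (win j r′ v₀)
  endΓ⁻ zero (c ∷ r) p = [] , c , r , refl , refl , tt , p
  endΓ⁻ (suc m) (c ∷ c′ ∷ r) p with to (T-∧ {c′ <ᵇ c}) p
  ... | c′<c , q with endΓ⁻ m (c′ ∷ r) q
  ... | [] , v₀ , r′ , refl , |v| , d , w =
    c ∷ [] , v₀ , r′ , refl , cong suc |v| , from (T-∧ {c′ <ᵇ c}) (c′<c , d) , w
  ... | _ ∷ v , v₀ , r′ , refl , |v| , d , w =
    c ∷ c′ ∷ v , v₀ , r′ , refl , cong suc |v| , from (T-∧ {c′ <ᵇ c}) (c′<c , d) , w

  endΓ⁺ : ∀ m v v₀ r → length v ≡ m → T (decr (v ++ v₀ ∷ [])) → T (win j r v₀) → T (endΓ m (v ++ v₀ ∷ r))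
  endΓ⁺ zero [] v₀ r _ d w = w
  endΓ⁺ (suc m) (c ∷ []) v₀ r |v| d w with to (T-∧ {v₀ <ᵇ c}) d
  ... | lt , d′ = from (T-∧ {v₀ <ᵇ c}) (lt , endΓ⁺ m [] v₀ r (ℕₚ.suc-injective |v|) d′ w)
  endΓ⁺ (suc m) (c ∷ c′ ∷ v) v₀ r |v| d w with to (T-∧ {c′ <ᵇ c}) d
  ... | lt , d′ = from (T-∧ {c′ <ᵇ c}) (lt , endΓ⁺ m (c′ ∷ v) v₀ r (ℕₚ.suc-injective |v|) d′ w)

  reverse₁ : ∀ v (v₀ : ℕ) → reverse (v ++ v₀ ∷ []) ≡ v₀ ∷ reverse v
  reverse₁ v v₀ = Lₚ.reverse-++ v (v₀ ∷ [])

  reverse₂ : ∀ u (u₁ u₀ : ℕ) → reverse (u ++ u₁ ∷ u₀ ∷ []) ≡ u₀ ∷ u₁ ∷ reverse u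
  reverse₂ u u₁ u₀ = Lₚ.reverse-++ u (u₁ ∷ u₀ ∷ [])

  ending⁻ : ∀ r → T (ending r) → ∃ λ g → ∃ λ r′ → r ≡ g ++ r′ × Match (reverse g)
  ending⁻ r p with to (T-∨ {dec s r}) p
  ... | inj₁ q with dec⁻ s r q
  ... | g , r′ , eq , |g| , d =
    g , r′ , eq , inj₂ (trans (Lₚ.length-reverse g) |g| , subst T (decr≡incr g) d)
  ending⁻ r p | inj₂ q with endΓ⁻ (suc j) r q
  ... | v , v₀ , r₁ , refl , |v| , dv , w with win⁻ j r₁ v₀ w
  ... | u , u₁ , u₀ , r′ , refl , |u| , du , lo , hi =
    V′ ++ U′ , r′ , eq , inj₁ (form u₀ u₁ (reverse u) v₀ (reverse v) rev≡
      (trans (Lₚ.length-reverse u) |u|) (trans (Lₚ.length-reverse v) |v|)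
      (subst T (trans (decr≡incr U′) (cong incr (reverse₂ u u₁ u₀))) du)
      (subst T (trans (decr≡incr V′) (cong incr (reverse₁ v v₀))) dv) lo hi)
    where
    V′ = v ++ v₀ ∷ []
    U′ = u ++ u₁ ∷ u₀ ∷ []
    eq : v ++ v₀ ∷ u ++ u₁ ∷ u₀ ∷ r′ ≡ (V′ ++ U′) ++ r′
    eq = sym (trans (Lₚ.++-assoc V′ U′ r′) (trans (Lₚ.++-assoc v (v₀ ∷ []) (U′ ++ r′))
           (cong (λ l → v ++ v₀ ∷ l) (Lₚ.++-assoc u (u₁ ∷ u₀ ∷ []) r′))))
    rev≡ : reverse (V′ ++ U′) ≡ (u₀ ∷ u₁ ∷ reverse u) ++ v₀ ∷ reverse v
    rev≡ = trans (Lₚ.reverse-++ V′ U′) (cong₂ _++_ (reverse₂ u u₁ u₀) (reverse₁ v v₀))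

  ending⁺ : ∀ g r → Match (reverse g) → T (ending (g ++ r))
  ending⁺ g r (inj₂ (|g| , i)) = from (T-∨ {dec s (g ++ r)}) (inj₁
    (dec⁺ s g r (trans (sym (Lₚ.length-reverse g)) |g|) (subst T (sym (decr≡incr g)) i)))
  ending⁺ g r (inj₁ (form u₀ u₁ u v₀ v eq |u| |v| iu iv lo hi)) = from (T-∨ {dec s (g ++ r)}) (inj₂
    (subst (T ∘ endΓ (suc j)) (sym g≡)
      (endΓ⁺ (suc j) (reverse v) v₀ (reverse u ++ u₁ ∷ u₀ ∷ r) (trans (Lₚ.length-reverse v) |v|)
        (subst T (trans (sym (decr-reverse (v₀ ∷ v))) (cong decr (Lₚ.unfold-reverse v₀ v))) iv)
        (win⁺ j (reverse u) u₁ u₀ r v₀ (trans (Lₚ.length-reverse u) |u|)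
          (subst T (trans (sym (decr-reverse (u₀ ∷ u₁ ∷ u))) (cong decr rev-u)) iu) lo hi))))
    where
    open ≡-Reasoning
    rev-u : reverse (u₀ ∷ u₁ ∷ u) ≡ reverse u ++ u₁ ∷ u₀ ∷ []
    rev-u = Lₚ.reverse-++ (u₀ ∷ u₁ ∷ []) u
    g≡ : g ++ r ≡ reverse v ++ v₀ ∷ reverse u ++ u₁ ∷ u₀ ∷ r
    g≡ = begin
      g ++ r ≡⟨ cong (_++ r) (trans (sym (Lₚ.reverse-involutive g)) (cong reverse eq)) ⟩
      reverse ((u₀ ∷ u₁ ∷ u) ++ v₀ ∷ v) ++ r
        ≡⟨ cong (_++ r) (trans (Lₚ.reverse-++ (u₀ ∷ u₁ ∷ u) (v₀ ∷ v)) (cong₂ _++_ (Lₚ.unfold-reverse v₀ v) rev-u)) ⟩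
      ((reverse v ++ v₀ ∷ []) ++ reverse u ++ u₁ ∷ u₀ ∷ []) ++ r
        ≡⟨ Lₚ.++-assoc (reverse v ++ v₀ ∷ []) _ r ⟩
      (reverse v ++ v₀ ∷ []) ++ (reverse u ++ u₁ ∷ u₀ ∷ []) ++ r
        ≡⟨ Lₚ.++-assoc (reverse v) (v₀ ∷ []) _ ⟩
      reverse v ++ v₀ ∷ (reverse u ++ u₁ ∷ u₀ ∷ []) ++ r
        ≡⟨ cong (λ l → reverse v ++ v₀ ∷ l) (Lₚ.++-assoc (reverse u) (u₁ ∷ u₀ ∷ []) r) ⟩
      reverse v ++ v₀ ∷ reverse u ++ u₁ ∷ u₀ ∷ r ∎

  Occurs : Word → Set
  Occurs r = ∃ λ p → ∃ λ g → ∃ λ q → r ≡ p ++ g ++ q × Match (reverse g)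

  Match-≢[] : ¬ Match []
  Match-≢[] (inj₁ (form _ _ _ _ _ () _ _ _ _ _ _))
  Match-≢[] (inj₂ (() , _))

  -- `matchAt` inspects only factors of two or more letters, so shorter patterns would escape it.
  Match-length : ∀ w → Match w → 2 ≤ length w
  Match-length w (inj₁ (form _ _ _ _ _ refl _ _ _ _ _ _)) = s≤s (s≤s z≤n)
  Match-length w (inj₂ (|w| , _)) = subst (2 ≤_) (sym |w|) (s≤s (ℕₚ.≤-trans (s≤s z≤n) k≤s))

  avoids⇒ : ∀ r → T (avoids r) → ¬ Occurs r
  avoids⇒ [] _ ([] , [] , _ , _ , m) = Match-≢[] m
  avoids⇒ [] _ ([] , _ ∷ _ , _ , () , _)
  avoids⇒ [] _ (_ ∷ _ , _ , _ , () , _)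
  avoids⇒ (c ∷ r) a (p , g , q , eq , m) with to (T-∧ {avoids r}) a
  avoids⇒ (c ∷ r) a ([] , g , q , eq , m) | _ , ne =
    T-not (subst (T ∘ ending) (sym eq) (ending⁺ g q m)) ne
    where
    T-not : ∀ {b} → T b → ¬ T (not b)
    T-not {true} _ ()
  avoids⇒ (c ∷ r) a (_ ∷ p , g , q , refl , m) | av , _ = avoids⇒ r av (p , g , q , refl , m)

  ⇒avoids : ∀ r → ¬ Occurs r → T (avoids r)
  ⇒avoids [] _ = tt
  ⇒avoids (c ∷ r) ¬occ = from (T-∧ {avoids r})
    (⇒avoids r (λ { (p , g , q , refl , m) → ¬occ (c ∷ p , g , q , refl , m) }) , ne (ending (c ∷ r)) refl)
    where
    ne : ∀ b → ending (c ∷ r) ≡ b → T (not b)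
    ne false _ = tt
    ne true eq with ending⁻ (c ∷ r) (from T-≡ eq)
    ... | g , q , eq′ , m = ¬occ ([] , g , q , eq′ , m)

  hasMatch⇒ : ∀ w → Unique w → T (hasMatch k s w) → Occurs (reverse w)
  hasMatch⇒ w uw p with any⁻ (upTo (length w)) p
  ... | i , _ , q with any⁻ (map suc (upTo (length w ∸ suc i))) q
  ... | l , _ , r = reverse q′ , reverse g , reverse (take i w) , eq ,
    subst Match (sym (Lₚ.reverse-involutive g))
      (Γ⇒Match g (Unique-factor (take i w) g q′ (subst Unique (sym w≡) uw)) r)
    where
    g = take (suc l) (drop i w)
    q′ = drop (suc l) (drop i w)
    w≡ : take i w ++ g ++ q′ ≡ w
    w≡ = trans (cong (take i w ++_) (Lₚ.take++drop≡id (suc l) (drop i w))) (Lₚ.take++drop≡id i w)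
    eq : reverse w ≡ reverse q′ ++ reverse g ++ reverse (take i w)
    eq = trans (cong reverse (sym w≡)) (trans (Lₚ.reverse-++ (take i w) (g ++ q′))
           (trans (cong (_++ reverse (take i w)) (Lₚ.reverse-++ g q′)) (Lₚ.++-assoc (reverse q′) (reverse g) _)))

  ⇒hasMatch : ∀ r → Unique r → Occurs r → T (hasMatch k s (reverse r))
  ⇒hasMatch r ur (p , g , q , refl , m) with reverse g in geq | Match-length (reverse g) m | Match⇒Γ (reverse g) (Unique-reverse g (Unique-factor p g q ur)) m
  ... | _ ∷ [] | s≤s () | _
  ... | a ∷ b ∷ g′ | _ | γ =
    any⁺ {p = matchAt k s w} (length α) (∈-upTo⁺ α<) (any⁺ (suc (length g′)) (∈-map⁺ suc (∈-upTo⁺ g′<))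
      (subst (T ∘ inΓ k s ∘ red) (sym take≡) γ))
    where
    w = reverse (p ++ g ++ q)
    α = reverse q
    δ = reverse p
    w≡ : w ≡ α ++ (a ∷ b ∷ g′) ++ δ
    w≡ = trans (Lₚ.reverse-++ p (g ++ q)) (trans (cong (_++ δ) (Lₚ.reverse-++ g q))
           (trans (Lₚ.++-assoc α (reverse g) δ) (cong (λ l → α ++ l ++ δ) geq)))
    |w| : length w ≡ suc (length α) + suc (length g′ + length δ)
    |w| = trans (cong length w≡) (trans (Lₚ.length-++ α) (trans
            (cong (λ n → length α + suc (suc n)) (Lₚ.length-++ g′)) (ℕₚ.+-suc (length α) _)))
    α< : length α < length w
    α< = subst (length α <_) (sym |w|) (s≤s (ℕₚ.m≤m+n _ _))
    g′< : length g′ < length w ∸ suc (length α)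
    g′< = subst (length g′ <_) (sym (trans (cong (_∸ suc (length α)) |w|) (ℕₚ.m+n∸m≡n (suc (length α)) _)))
            (s≤s (ℕₚ.m≤m+n _ _))
    take≡ : take (suc (suc (length g′))) (drop (length α) w) ≡ a ∷ b ∷ g′
    take≡ = trans (cong (take (suc (suc (length g′)))) (trans (cong (drop (length α)) w≡) (drop-≡ α _ refl)))
              (take-≡ (a ∷ b ∷ g′) δ refl)

  avoids≡ : ∀ r → Unique r → not (hasMatch k s (reverse r)) ≡ avoids r
  avoids≡ r ur = T-⇔⇒≡
    (λ nm → ⇒avoids r (λ o → T-not⁻ nm (⇒hasMatch r ur o)))
    (λ av → T-not⁺ λ hm → avoids⇒ r av (subst Occurs (Lₚ.reverse-involutive r)
               (hasMatch⇒ (reverse r) (Unique-reverse r ur) hm)))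
    where
    T-not⁻ : ∀ {b} → T (not b) → ¬ T b
    T-not⁻ {false} _ ()
    T-not⁺ : ∀ {b} → ¬ T b → T (not b)
    T-not⁺ {false} _ = tt
    T-not⁺ {true} f = f tt

-- Conditions as factors, powers of y, and the weight of a prefix

infixr 5 _▸_

_▸_ : Bool → ℤ → ℤ
b ▸ e = if b then e else + 0

∧-▸ : ∀ a b e → (a ∧ b) ▸ e ≡ a ▸ (b ▸ e)
∧-▸ false b e = refl
∧-▸ true b e = refl

▸-+ : ∀ b e f → b ▸ (e ℤ.+ f) ≡ (b ▸ e) ℤ.+ (b ▸ f)
▸-+ false e f = refl
▸-+ true e f = refl

▸-zero : ∀ b → b ▸ + 0 ≡ + 0
▸-zero false = refl
▸-zero true = refl

sh : Poly → Poly
sh p zero = + 0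
sh p (suc d) = p d

-- Multiplication by the `n`-th power of `y`. The newest factor is applied first, so that a new
-- descent at the end of a prefix unfolds to an `sh` under the old power.
shⁿ : ℕ → Poly → Poly
shⁿ zero p = p
shⁿ (suc n) p = shⁿ n (sh p)

sh-cong : ∀ {p q} → p ≈ᴾ q → sh p ≈ᴾ sh q
sh-cong p≈q zero = refl
sh-cong p≈q (suc d) = p≈q d

shⁿ-cong : ∀ n {p q} → p ≈ᴾ q → shⁿ n p ≈ᴾ shⁿ n q
shⁿ-cong zero p≈q = p≈q
shⁿ-cong (suc n) p≈q = shⁿ-cong n (sh-cong p≈q)

shⁿ-linear : ∀ n b p q → shⁿ n (λ d → (b ▸ p d) ℤ.+ q d) ≈ᴾ (λ d → (b ▸ shⁿ n p d) ℤ.+ shⁿ n q d)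
shⁿ-linear zero b p q d = refl
shⁿ-linear (suc n) b p q d = trans (shⁿ-cong n sh-linear d) (shⁿ-linear n b (sh p) (sh q) d)
  where
  sh-linear : sh (λ d → (b ▸ p d) ℤ.+ q d) ≈ᴾ (λ d → (b ▸ sh p d) ℤ.+ sh q d)
  sh-linear zero = sym (trans (ℤₚ.+-identityʳ _) (▸-zero b))
  sh-linear (suc d) = refl

weight : Word → ℕ
weight [] = 0
weight (x ∷ []) = 1
weight (x ∷ c ∷ r) = (if x <ᵇ c then 1 else 0) + weight (c ∷ r)

-- The empty word gets 0 because the constant term of the inverted series is 1, without a factor
-- `y`.
wt : Word → ℕ
wt [] = 0
wt w@(_ ∷ _) = suc (des w)

+-left-comm : ∀ a b c → a + (b + c) ≡ b + (a + c)
+-left-comm a b c = trans (sym (ℕₚ.+-assoc a b c)) (trans (cong (_+ c) (ℕₚ.+-comm a b)) (ℕₚ.+-assoc b a c))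

des-∷ʳ : ∀ w x y → des (w ++ x ∷ y ∷ []) ≡ (if y <ᵇ x then 1 else 0) + des (w ++ x ∷ [])
des-∷ʳ [] x y = refl
des-∷ʳ (a ∷ []) x y = +-left-comm (if x <ᵇ a then 1 else 0) (if y <ᵇ x then 1 else 0) 0
des-∷ʳ (a ∷ b ∷ w) x y =
  trans (cong (λ n → (if b <ᵇ a then 1 else 0) + n) (des-∷ʳ (b ∷ w) x y))
        (+-left-comm (if b <ᵇ a then 1 else 0) (if y <ᵇ x then 1 else 0) (des (b ∷ w ++ x ∷ [])))

wt-∷ʳ : ∀ w x → wt (w ++ x ∷ []) ≡ suc (des (w ++ x ∷ []))
wt-∷ʳ [] x = refl
wt-∷ʳ (_ ∷ _) x = refl

weight≡wt : ∀ r → weight r ≡ wt (reverse r)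
weight≡wt [] = refl
weight≡wt (x ∷ []) = refl
weight≡wt (x ∷ c ∷ r) = begin
  b + weight (c ∷ r)                     ≡⟨ cong (λ n → b + n) (weight≡wt (c ∷ r)) ⟩
  b + wt (reverse (c ∷ r))               ≡⟨ cong (λ w → b + wt w) (Lₚ.unfold-reverse c r) ⟩
  b + wt (reverse r ∷ʳ c)                ≡⟨ cong (λ n → b + n) (wt-∷ʳ (reverse r) c) ⟩
  b + suc (des (reverse r ∷ʳ c))         ≡⟨ ℕₚ.+-suc b _ ⟩
  suc (b + des (reverse r ∷ʳ c))         ≡⟨ cong suc (des-∷ʳ (reverse r) c x) ⟨
  suc (des (reverse r ++ c ∷ x ∷ []))    ≡⟨ cong (suc ∘ des) (Lₚ.++-assoc (reverse r) (c ∷ []) (x ∷ [])) ⟨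
  suc (des ((reverse r ∷ʳ c) ∷ʳ x))      ≡⟨ wt-∷ʳ (reverse r ∷ʳ c) x ⟨
  wt ((reverse r ∷ʳ c) ∷ʳ x)             ≡⟨ cong (λ w → wt (w ∷ʳ x)) (Lₚ.unfold-reverse c r) ⟨
  wt (reverse (c ∷ r) ∷ʳ x)              ≡⟨ cong wt (Lₚ.unfold-reverse x (c ∷ r)) ⟨
  wt (reverse (x ∷ c ∷ r)) ∎
  where
  open ≡-Reasoning
  b = if x <ᵇ c then 1 else 0

sum-upTo : ∀ (g : ℕ → ℤ) n → sumℤ (map g (upTo (suc n))) ≡ g 0 ℤ.+ sumℤ (map (g ∘ suc) (upTo n))
sum-upTo g n = cong (λ l → g 0 ℤ.+ sumℤ l) (trans (Lₚ.map-applyUpTo suc g n) (sym (Lₚ.map-upTo (g ∘ suc) n)))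

-- Tilings and the cancellation on a fixed word

module Bricks (j s : ℕ) (k≤s : suc (suc j) ≤ s) where
  open Matches j s
  open Endings j s k≤s

  small short long : Word → Bool
  small w = length w <ᵇ k
  short w = length w <ᵇ suc s
  long w = not (length w <ᵇ k) ∧ (length w <ᵇ suc s)

  asc : Word → ℕ → Bool
  asc [] x = false
  asc (c ∷ r) x = c <ᵇ x

  -- brick ok r w enumerates the ways to complete the current brick (read so far, in reverse, as r) with letters of w
  -- and to cut the rest of w into bricks; ok is the condition on the completed brick.
  brick : (Word → Bool) → Word → Word → Poly
  next : Word → ℕ → Word → Poly
  start : (Word → Bool) → ℕ → Word → Poly

  brick ok r [] d = ok r ▸ 1ᴾ d
  brick ok r (x ∷ w) d = (ok r ▸ next r x w d) ℤ.+ (asc r x ▸ brick ok (x ∷ r) w d)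

  -- At a descent, `win` checks the last `k` letters of the left brick against `x`, and `long`
  -- provides the `k` letters needed on the right.
  next r x w d = if asc r x then start short x w d else (win j r x ▸ start long x w d)

  start ok x w zero = + 0
  start ok x w (suc d) = ℤ.- brick ok (x ∷ []) w d

  tilings : Word → Poly
  tilings [] = 1ᴾ
  tilings (x ∷ w) = start short x w

  -- Restricted to nonempty bricks since `small` accepts the empty word, whereas the interval of
  -- lengths from 1 to `k - 1`, with which it is compared later, does not.
  brick-ok-cong : ∀ {ok ok′} → (∀ c r → ok (c ∷ r) ≡ ok′ (c ∷ r)) → ∀ c r w d → brick ok (c ∷ r) w d ≡ brick ok′ (c ∷ r) w d
  brick-ok-cong eq c r [] d = cong (_▸ 1ᴾ d) (eq c r)
  brick-ok-cong eq c r (x ∷ w) d =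
    cong₂ ℤ._+_ (cong (_▸ next (c ∷ r) x w d) (eq c r)) (cong ((c <ᵇ x) ▸_) (brick-ok-cong eq x (c ∷ r) w d))

  -- `ok` tests the current brick only, once in each summand; the later bricks carry conditions of
  -- their own. Hence linearity.
  brick-ok-+ : ∀ {ok ok₁ ok₂} → (∀ r e → ok r ▸ e ≡ (ok₁ r ▸ e) ℤ.+ (ok₂ r ▸ e)) →
               ∀ r w d → brick ok r w d ≡ brick ok₁ r w d ℤ.+ brick ok₂ r w d
  brick-ok-+ eq r [] d = eq r (1ᴾ d)
  brick-ok-+ {ok} {ok₁} {ok₂} eq r (x ∷ w) d = begin
    (ok r ▸ n) ℤ.+ (asc r x ▸ brick ok (x ∷ r) w d)
      ≡⟨ cong₂ ℤ._+_ (eq r n) (trans (cong (asc r x ▸_) (brick-ok-+ eq (x ∷ r) w d)) (▸-+ (asc r x) _ _)) ⟩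
    (ok₁ r ▸ n) ℤ.+ (ok₂ r ▸ n) ℤ.+ ((asc r x ▸ brick ok₁ (x ∷ r) w d) ℤ.+ (asc r x ▸ brick ok₂ (x ∷ r) w d))
      ≡⟨ interchange (ok₁ r ▸ n) (ok₂ r ▸ n) (asc r x ▸ brick ok₁ (x ∷ r) w d) (asc r x ▸ brick ok₂ (x ∷ r) w d) ⟩
    brick ok₁ r (x ∷ w) d ℤ.+ brick ok₂ r (x ∷ w) d ∎
    where
    open ≡-Reasoning
    n = next r x w d

  short-split : ∀ r e → short r ▸ e ≡ (small r ▸ e) ℤ.+ (long r ▸ e)
  short-split r e with length r <ᵇ k in eq
  ... | false = sym (ℤₚ.+-identityˡ _)
  ... | true rewrite <ᵇ-true {length r} {suc s} (ℕₚ.<-trans (ℕₚ.<ᵇ⇒< (length r) k (from T-≡ eq)) (s≤s k≤s)) =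
    sym (ℤₚ.+-identityʳ _)

  LengthOnly : (Word → Bool) → Set
  LengthOnly ok = ∀ zr → ok (map proj₁ zr) ≡ ok (map proj₂ zr)

  short-length : LengthOnly short
  short-length zr = cong (_<ᵇ suc s) (length-proj zr)

  long-length : LengthOnly long
  long-length zr = cong (λ n → not (n <ᵇ k) ∧ (n <ᵇ suc s)) (length-proj zr)

  module _ {z : List (ℕ × ℕ)} (iso : Iso z) where

    win-Iso : ∀ i {zr} → All (_∈ z) zr → ∀ {p} → p ∈ z → win i (map proj₁ zr) (proj₁ p) ≡ win i (map proj₂ zr) (proj₂ p)
    win-Iso i [] p∈ = refl
    win-Iso i (_ ∷ []) p∈ = refl
    win-Iso zero (c∈ ∷ c′∈ ∷ _) p∈ = cong₂ _∧_ (iso p∈ c∈) (iso c′∈ p∈)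
    win-Iso (suc i) (c∈ ∷ c′∈ ∷ r∈) p∈ = cong₂ _∧_ (iso c′∈ c∈) (win-Iso i (c′∈ ∷ r∈) p∈)

    asc-Iso : ∀ {zr} → All (_∈ z) zr → ∀ {p} → p ∈ z → asc (map proj₁ zr) (proj₁ p) ≡ asc (map proj₂ zr) (proj₂ p)
    asc-Iso [] p∈ = refl
    asc-Iso (c∈ ∷ _) p∈ = iso c∈ p∈

    brick-Iso : ∀ {ok} → LengthOnly ok → ∀ {zr zw} → All (_∈ z) zr → All (_∈ z) zw →
                ∀ d → brick ok (map proj₁ zr) (map proj₁ zw) d ≡ brick ok (map proj₂ zr) (map proj₂ zw) d
    start-Iso : ∀ {ok} → LengthOnly ok → ∀ {p zw} → p ∈ z → All (_∈ z) zw →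
                ∀ d → start ok (proj₁ p) (map proj₁ zw) d ≡ start ok (proj₂ p) (map proj₂ zw) d
    brick-Iso ok≡ {zr} r∈ [] d = cong (_▸ 1ᴾ d) (ok≡ zr)
    brick-Iso {ok} ok≡ {zr} {p ∷ zw} r∈ (p∈ ∷ w∈) d =
      cong₂ ℤ._+_
        (cong₂ _▸_ (ok≡ zr)
          (trans (cong₂ (λ a e → if a then e else (win j (map proj₁ zr) (proj₁ p) ▸ start long (proj₁ p) (map proj₁ zw) d))
                   (asc-Iso r∈ p∈) (start-Iso short-length p∈ w∈ d))
                 (cong₂ (λ b e → if asc (map proj₂ zr) (proj₂ p) then start short (proj₂ p) (map proj₂ zw) d else (b ▸ e))
                   (win-Iso j r∈ p∈) (start-Iso long-length p∈ w∈ d))))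
        (cong₂ _▸_ (asc-Iso r∈ p∈) (brick-Iso ok≡ (p∈ ∷ r∈) w∈ d))
    start-Iso ok≡ p∈ w∈ zero = refl
    start-Iso ok≡ p∈ w∈ (suc d) = cong ℤ.-_ (brick-Iso ok≡ (p∈ ∷ []) w∈ d)

  -- Seg r x n q q′ (all words reversed): q is the word r followed by a descent and then by an increasing run q′ of length n + 1 starting with x.
  Below : ℕ → Word → Set
  Below x [] = ⊤
  Below x (c ∷ r) = x < c

  data Seg (r : Word) (x : ℕ) : ℕ → Word → Word → Set where
    one : Below x r → Seg r x 0 (x ∷ r) (x ∷ [])
    ext : ∀ {n c q q′ y} → Seg r x n (c ∷ q) (c ∷ q′) → c < y → Seg r x (suc n) (y ∷ c ∷ q) (y ∷ c ∷ q′)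

  Seg-length : ∀ {r x n q q′} → Seg r x n q q′ → length q′ ≡ suc n
  Seg-length (one _) = refl
  Seg-length (ext seg _) = cong suc (Seg-length seg)

  Seg-dec : ∀ {r x n q q′} → Seg r x n q q′ → ∀ i → dec i q ≡ (i <ᵇ suc n)
  Seg-dec (one _) zero = refl
  Seg-dec {[]} (one _) (suc i) = refl
  Seg-dec {c ∷ r} (one x<c) (suc i) rewrite <ᵇ-false (ℕₚ.<⇒≤ x<c) = refl
  Seg-dec (ext seg c<y) zero = refl
  Seg-dec (ext seg c<y) (suc i) rewrite <ᵇ-true c<y = Seg-dec seg i

  -- A window puts `y` below its second letter `u₁`, which is at most the last letter `c`.
  win-above : ∀ i c r y → c < y → win i (c ∷ r) y ≡ false
  win-above i c [] y c<y = refl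
  win-above zero c (c′ ∷ r) y c<y rewrite <ᵇ-false (ℕₚ.<⇒≤ c<y) = refl
  win-above (suc i) c (c′ ∷ r) y c<y with c′ <ᵇ c in eq
  ... | false = refl
  ... | true = win-above i c′ r y (ℕₚ.<-trans (ℕₚ.<ᵇ⇒< c′ c (from T-≡ eq)) c<y)

  -- The second half of a pattern is preceded by a descent, so by `win-above` it can start nowhere
  -- inside the last run except at `x`.
  Seg-endΓ : ∀ {r x n q q′} → Seg r x n q q′ → ∀ i → endΓ i q ≡ (i ≡ᵇ n) ∧ win j r x
  Seg-endΓ (one _) zero = refl
  Seg-endΓ {[]} (one _) (suc i) = refl
  Seg-endΓ {c ∷ r} (one x<c) (suc i) rewrite <ᵇ-false (ℕₚ.<⇒≤ x<c) = refl
  Seg-endΓ (ext {c = c} {q = q} {y = y} seg c<y) zero = win-above j c q y c<y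
  Seg-endΓ (ext seg c<y) (suc i) rewrite <ᵇ-true c<y = Seg-endΓ seg i

  -- A window is an increasing run and cannot reach across the descent before `x`.
  Seg-win : ∀ {r x n q q′} → Seg r x n q q′ → ∀ i y → win i q y ≡ win i q′ y
  Seg-win {[]} (one _) i y = refl
  Seg-win {c ∷ r} {x} (one x<c) zero y with y <ᵇ x in eq
  ... | false = refl
  ... | true = <ᵇ-false (ℕₚ.<⇒≤ (ℕₚ.<-trans (ℕₚ.<ᵇ⇒< y x (from T-≡ eq)) x<c))
  Seg-win {c ∷ r} (one x<c) (suc i) y rewrite <ᵇ-false (ℕₚ.<⇒≤ x<c) = refl
  Seg-win (ext seg c<y) zero y = refl
  Seg-win (ext seg c<y) (suc i) y rewrite <ᵇ-true c<y = Seg-win seg i y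

  -- The admissible lengths of the last run. After a window (`b` true) the `k`-th letter would
  -- complete a pattern of Γ_{k,k}; otherwise only the identity pattern, at letter `s + 1`, is to be
  -- feared.
  limit : Bool → ℕ → Bool
  limit b n = if b then n <ᵇ k else n <ᵇ suc s

  limit-suc : ∀ b n → limit b (suc n) ∧ not ((s <ᵇ suc (suc n)) ∨ ((suc j ≡ᵇ suc n) ∧ b)) ≡ limit b (suc (suc n))
  limit-suc true n with ℕₚ.<-cmp n j
  ... | tri< n<j n≢j _
    rewrite <ᵇ-true n<j | <ᵇ-true {n} {suc j} (ℕₚ.m<n⇒m<1+n n<j) | ≡ᵇ-false (≢-sym n≢j)
          | <ᵇ-false {s} {suc (suc n)} (ℕₚ.≤-trans (s≤s (ℕₚ.m≤n⇒m≤1+n n<j)) k≤s) = refl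
  -- Here the run reaches length `k` after a window.
  ... | tri≈ _ refl _
    rewrite <ᵇ-false {n} {n} ℕₚ.≤-refl | ≡ᵇ-true n with s <ᵇ suc (suc n)
  ...   | false = ∧-zeroʳ (n <ᵇ suc n)
  ...   | true = ∧-zeroʳ (n <ᵇ suc n)
  limit-suc true n | tri> _ _ j<n rewrite <ᵇ-false {n} {suc j} j<n | <ᵇ-false (ℕₚ.<⇒≤ j<n) = refl
  limit-suc false n with suc n ℕₚ.<? s
  ... | yes n<s rewrite <ᵇ-true n<s | <ᵇ-true {n} {s} (ℕₚ.<-trans (ℕₚ.n<1+n n) n<s) | <ᵇ-false {s} {suc (suc n)} n<s with j ≡ᵇ n
  ...   | false = refl
  ...   | true = refl
  limit-suc false n | no n≮s
    rewrite <ᵇ-false {suc n} {s} (ℕₚ.≮⇒≥ n≮s) | <ᵇ-true {s} {suc (suc n)} (s≤s (ℕₚ.≮⇒≥ n≮s)) with n <ᵇ s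
  ...   | false = refl
  ...   | true = refl

  Seg-avoids : ∀ {r x n q q′} → Seg r x n q q′ → avoids q ≡ avoids r ∧ limit (win j r x) (suc n)
  Seg-avoids {r} {x} seg@(one _) rewrite Seg-dec seg s | Seg-endΓ seg (suc j) = cong (avoids r ∧_) (base s k≤s (win j r x))
    where
    base : ∀ s → k ≤ s → ∀ b → not ((s <ᵇ 1) ∨ false) ≡ (if b then 1 <ᵇ k else 1 <ᵇ suc s)
    base (suc zero) (s≤s ()) _
    base (suc (suc s)) _ true = refl
    base (suc (suc s)) _ false = refl
  Seg-avoids {r} {x} {suc n} seg@(ext seg′ c<y)
    rewrite Seg-dec seg s | Seg-endΓ seg (suc j) | Seg-avoids seg′ =
    trans (∧-assoc (avoids r) _ _) (cong (avoids r ∧_) (limit-suc (win j r x) n))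

  limited : Bool → Word → Bool
  limited b w = limit b (length w)

  next-cong : ∀ c q q′ x w d → win j (c ∷ q) x ≡ win j (c ∷ q′) x → next (c ∷ q) x w d ≡ next (c ∷ q′) x w d
  next-cong c q q′ x w d eq = cong (λ b → if c <ᵇ x then start short x w d else (b ▸ start long x w d)) eq

  Seg-▸ : ∀ {r x n q q′} → Seg r x n q q′ → ∀ e → avoids q ▸ e ≡ avoids r ▸ limited (win j r x) q′ ▸ e
  Seg-▸ {r} {x} {q′ = q′} seg e =
    trans (cong (_▸ e) (trans (Seg-avoids seg) (cong (λ m → avoids r ∧ limit (win j r x) m) (sym (Seg-length seg)))))
          (∧-▸ (avoids r) (limited (win j r x) q′) e)

  -- Avoidance of the grown prefix is avoidance of `r` together with a bound on the length of the
  -- last run, and the boundary after it sees this run alone by `Seg-win`. So the last run may be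
  -- treated as a brick.
  Seg-brick : ∀ {r x n c q q′} → Seg r x n (c ∷ q) (c ∷ q′) → ∀ w d →
              brick avoids (c ∷ q) w d ≡ avoids r ▸ brick (limited (win j r x)) (c ∷ q′) w d
  Seg-brick seg [] d = Seg-▸ seg (1ᴾ d)
  Seg-brick {r} {x} {n} {c} {q} {q′} seg (y ∷ w) d = begin
    (avoids (c ∷ q) ▸ next (c ∷ q) y w d) ℤ.+ ((c <ᵇ y) ▸ brick avoids (y ∷ c ∷ q) w d)
      ≡⟨ cong₂ ℤ._+_ (trans (cong (avoids (c ∷ q) ▸_) (next-cong c q q′ y w d (Seg-win seg j y))) (Seg-▸ seg _)) later ⟩
    (avoids r ▸ limited b (c ∷ q′) ▸ next (c ∷ q′) y w d) ℤ.+ (avoids r ▸ (c <ᵇ y) ▸ brick (limited b) (y ∷ c ∷ q′) w d)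
      ≡⟨ ▸-+ (avoids r) _ _ ⟨
    avoids r ▸ brick (limited b) (c ∷ q′) (y ∷ w) d ∎
    where
    open ≡-Reasoning
    b = win j r x
    later : (c <ᵇ y) ▸ brick avoids (y ∷ c ∷ q) w d ≡ avoids r ▸ (c <ᵇ y) ▸ brick (limited b) (y ∷ c ∷ q′) w d
    later with c <ᵇ y in eq
    ... | false = sym (▸-zero (avoids r))
    ... | true = Seg-brick (ext seg (ℕₚ.<ᵇ⇒< c y (from T-≡ eq))) w d

  -- The sign-reversing involution at one cut: the run starting at `x` has the factor `-y` as a
  -- first brick, and `y` as the last run of the prefix. Without a window both range over `short`
  -- and cancel. After a window the prefix accepts only `small` runs, and `short` minus `small`
  -- leaves `long`, which is the value of `next` at a descent.
  descent-cancel : ∀ r x → Below x r → ∀ w d →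
    (avoids r ▸ start short x w d) ℤ.+ sh (brick avoids (x ∷ r) w) d ≡ avoids r ▸ win j r x ▸ start long x w d
  descent-cancel r x below w zero =
    trans (ℤₚ.+-identityʳ _) (cong (avoids r ▸_) (sym (▸-zero (win j r x))))
  descent-cancel r x below w (suc d) rewrite Seg-brick (one {r} below) w d with avoids r | win j r x
  ... | false | _ = refl
  ... | true | false = ℤₚ.+-inverseˡ (brick short (x ∷ []) w d)
  ... | true | true rewrite brick-ok-+ short-split (x ∷ []) w d = cancel (brick small (x ∷ []) w d) (brick long (x ∷ []) w d)
    where
    cancel : ∀ a b → ℤ.- (a ℤ.+ b) ℤ.+ a ≡ ℤ.- b
    cancel = solve-∀

  -- The signed sum over all splittings whose prefix extends reverse r.
  total : Word → Word → Poly
  total r [] d = avoids r ▸ shⁿ (weight r) 1ᴾ d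
  total r (x ∷ w) d = (avoids r ▸ shⁿ (weight r) (tilings (x ∷ w)) d) ℤ.+ total (x ∷ r) w d

  -- After all cancellations the surviving splittings are those whose prefix extends `c ∷ r` by
  -- ascents only and whose boundary obeys the rule for tilings; `brick` with `avoids` as its
  -- condition enumerates them. Nothing cancels at an ascent.
  total≡ : ∀ c r w → Unique (c ∷ w) → ∀ d → total (c ∷ r) w d ≡ shⁿ (weight (c ∷ r)) (brick avoids (c ∷ r) w) d
  total≡ c r [] _ d = begin
    avoids (c ∷ r) ▸ shⁿ n 1ᴾ d                                 ≡⟨ ℤₚ.+-identityʳ _ ⟨
    (avoids (c ∷ r) ▸ shⁿ n 1ᴾ d) ℤ.+ + 0                       ≡⟨ cong (ℤ._+_ (avoids (c ∷ r) ▸ shⁿ n 1ᴾ d)) (shⁿ-0 n d) ⟨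
    (avoids (c ∷ r) ▸ shⁿ n 1ᴾ d) ℤ.+ shⁿ n 0ᴾ d                ≡⟨ shⁿ-linear n (avoids (c ∷ r)) 1ᴾ 0ᴾ d ⟨
    shⁿ n (λ d → (avoids (c ∷ r) ▸ 1ᴾ d) ℤ.+ + 0) d             ≡⟨ shⁿ-cong n (λ d → ℤₚ.+-identityʳ _) d ⟩
    shⁿ n (brick avoids (c ∷ r) []) d ∎
    where
    open ≡-Reasoning
    n = weight (c ∷ r)
    sh-0 : sh 0ᴾ ≈ᴾ 0ᴾ
    sh-0 zero = refl
    sh-0 (suc d) = refl
    shⁿ-0 : ∀ n → shⁿ n 0ᴾ ≈ᴾ 0ᴾ
    shⁿ-0 zero d = refl
    shⁿ-0 (suc n) d = trans (shⁿ-cong n sh-0 d) (shⁿ-0 n d)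
  total≡ c r (x ∷ w) ((c≢x ∷ _) ∷ uw) d rewrite total≡ x (c ∷ r) w uw d with ℕₚ.<-cmp c x
  ... | tri≈ _ c≡x _ = ⊥-elim (c≢x c≡x)
  ... | tri< c<x _ _ rewrite <ᵇ-false (ℕₚ.<⇒≤ c<x) | <ᵇ-true c<x =
    sym (shⁿ-linear (weight (c ∷ r)) (avoids (c ∷ r)) (start short x w) (brick avoids (x ∷ c ∷ r) w) d)
  -- The descent from `c` to `x` raises the weight by one, which supplies the `sh` required by
  -- `descent-cancel`.
  ... | tri> _ _ x<c rewrite <ᵇ-true x<c | <ᵇ-false (ℕₚ.<⇒≤ x<c) =
    trans (sym (shⁿ-linear (weight (c ∷ r)) (avoids (c ∷ r)) (start short x w) (sh (brick avoids (x ∷ c ∷ r) w)) d))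
          (shⁿ-cong (weight (c ∷ r)) (λ d → trans (descent-cancel (c ∷ r) x x<c w d) (sym (ℤₚ.+-identityʳ _))) d)

  -- The empty prefix counts as a descent before `x` (`Below x []`) but offers no window, so the
  -- remainder in `descent-cancel` is zero.
  total-cancel : ∀ x w → Unique (x ∷ w) → ∀ d → total [] (x ∷ w) d ≡ + 0
  total-cancel x w uw d = trans (cong (ℤ._+_ (start short x w d)) (total≡ x [] w uw d)) (descent-cancel [] x tt w d)

  term : ℕ → Word → Word → ℤ
  term d u v = not (hasMatch k s u) ▸ shⁿ (wt u) (tilings v) d

  total≡sum : ∀ r w → Unique (reverse w ++ r) → ∀ d →
              sumℤ (map (λ i → term d (reverse r ++ take i w) (drop i w)) (upTo (suc (length w)))) ≡ total r w d
  total≡sum r [] ur d = begin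
    term d (reverse r ++ []) [] ℤ.+ + 0 ≡⟨ ℤₚ.+-identityʳ _ ⟩
    term d (reverse r ++ []) []         ≡⟨ cong (λ u → term d u []) (Lₚ.++-identityʳ (reverse r)) ⟩
    term d (reverse r) []               ≡⟨ cong₂ (λ b n → b ▸ shⁿ n 1ᴾ d) (avoids≡ r ur) (sym (weight≡wt r)) ⟩
    avoids r ▸ shⁿ (weight r) 1ᴾ d      ∎
    where open ≡-Reasoning
  total≡sum r (x ∷ w) u d = begin
    sumℤ (map g (upTo (suc (suc (length w)))))
      ≡⟨ sum-upTo g (suc (length w)) ⟩
    g 0 ℤ.+ sumℤ (map (g ∘ suc) (upTo (suc (length w))))
      ≡⟨ cong₂ ℤ._+_ head≡ (trans (cong sumℤ (Lₚ.map-cong tail≡ (upTo (suc (length w))))) (total≡sum (x ∷ r) w u′ d)) ⟩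
    total r (x ∷ w) d ∎
    where
    open ≡-Reasoning
    g : ℕ → ℤ
    g i = term d (reverse r ++ take i (x ∷ w)) (drop i (x ∷ w))
    u′ : Unique (reverse w ++ x ∷ r)
    u′ = subst Unique (trans (cong (_++ r) (Lₚ.unfold-reverse x w)) (Lₚ.++-assoc (reverse w) (x ∷ []) r)) u
    ur : Unique r
    ur = Unique-factor (reverse (x ∷ w)) r [] (subst (λ l → Unique (reverse (x ∷ w) ++ l)) (sym (Lₚ.++-identityʳ r)) u)
    head≡ : g 0 ≡ avoids r ▸ shⁿ (weight r) (tilings (x ∷ w)) d
    head≡ = trans (cong (λ v → term d v (x ∷ w)) (Lₚ.++-identityʳ (reverse r)))
                  (cong₂ (λ b n → b ▸ shⁿ n (tilings (x ∷ w)) d) (avoids≡ r ur) (sym (weight≡wt r)))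
    tail≡ : ∀ i → g (suc i) ≡ term d (reverse (x ∷ r) ++ take i w) (drop i w)
    tail≡ i = cong (λ v → term d v (drop i w)) (sym (trans (cong (_++ take i w) (Lₚ.unfold-reverse x r))
                (Lₚ.++-assoc (reverse r) (x ∷ []) (take i w))))

  sum-term : ∀ n w → length w ≡ suc n → Unique w → ∀ d → sumℤ (map (λ i → split i (term d) w) (upTo (suc (suc n)))) ≡ + 0
  sum-term n (x ∷ w) refl uw d = trans (total≡sum [] (x ∷ w)
    (subst Unique (sym (Lₚ.++-identityʳ (reverse (x ∷ w)))) (Unique-reverse (x ∷ w) uw)) d) (total-cancel x w uw d)

-- Order invariance of descents and of matches

below-Iso : ∀ {z} → Iso z → ∀ {z′ p} → z′ ⊆ z → p ∈ z → below (proj₁ p) (map proj₁ z′) ≡ below (proj₂ p) (map proj₂ z′)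
below-Iso iso {[]} z′⊆ p∈ = refl
below-Iso iso {q ∷ z′} z′⊆ p∈ =
  cong₂ (λ b n → (if b then 1 else 0) + n) (iso (z′⊆ (here refl)) p∈) (below-Iso iso {z′} (z′⊆ ∘ there) p∈)

red-Inv : Inv red
red-Inv z iso = begin
  map (λ a → suc (below a (map proj₁ z))) (map proj₁ z)  ≡⟨ Lₚ.map-∘ z ⟨
  map (λ p → suc (below (proj₁ p) (map proj₁ z))) z      ≡⟨ Lₚ.map-cong-local (All.tabulate λ p∈ → cong suc (below-Iso iso id p∈)) ⟩
  map (λ p → suc (below (proj₂ p) (map proj₂ z))) z      ≡⟨ Lₚ.map-∘ z ⟩
  map (λ a → suc (below a (map proj₂ z))) (map proj₂ z)  ∎
  where open ≡-Reasoning

∈-take : ∀ {X : Set} n {xs : List X} {x} → x ∈ take n xs → x ∈ xs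
∈-take (suc n) {_ ∷ _} (here refl) = here refl
∈-take (suc n) {_ ∷ _} (there x∈) = there (∈-take n x∈)

∈-drop : ∀ {X : Set} n {xs : List X} {x} → x ∈ drop n xs → x ∈ xs
∈-drop zero x∈ = x∈
∈-drop (suc n) {_ ∷ _} x∈ = there (∈-drop n x∈)

hasMatch-Inv : ∀ k s → Inv (hasMatch k s)
hasMatch-Inv k s z iso = begin
  or (map (matchAt k s (map proj₁ z)) (upTo (length (map proj₁ z))))
    ≡⟨ cong (λ n → or (map (matchAt k s (map proj₁ z)) (upTo n))) (length-proj z) ⟩
  or (map (matchAt k s (map proj₁ z)) (upTo (length (map proj₂ z))))
    ≡⟨ cong or (Lₚ.map-cong at (upTo (length (map proj₂ z)))) ⟩
  or (map (matchAt k s (map proj₂ z)) (upTo (length (map proj₂ z)))) ∎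
  where
  open ≡-Reasoning
  factor : ∀ (f : ℕ × ℕ → ℕ) i l → take l (drop i (map f z)) ≡ map f (take l (drop i z))
  factor f i l = trans (cong (take l) (Lₚ.drop-map i z)) (Lₚ.take-map l (drop i z))
  at : ∀ i → matchAt k s (map proj₁ z) i ≡ matchAt k s (map proj₂ z) i
  at i = cong or (trans
    (cong (λ n → map (λ l → inΓ k s (red (take (suc l) (drop i (map proj₁ z))))) (map suc (upTo (n ∸ suc i)))) (length-proj z))
    (Lₚ.map-cong (λ l → cong (inΓ k s) (begin
        red (take (suc l) (drop i (map proj₁ z)))  ≡⟨ cong red (factor proj₁ i (suc l)) ⟩
        red (map proj₁ (take (suc l) (drop i z)))  ≡⟨ red-Inv _ (Iso-⊆ (∈-drop i ∘ ∈-take (suc l)) iso) ⟩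
        red (map proj₂ (take (suc l) (drop i z)))  ≡⟨ cong red (factor proj₂ i (suc l)) ⟨
        red (take (suc l) (drop i (map proj₂ z)))  ∎))
      (map suc (upTo (length (map proj₂ z) ∸ suc i)))))

des-Inv : Inv des
des-Inv [] iso = refl
des-Inv (p ∷ []) iso = refl
des-Inv (p ∷ q ∷ z) iso =
  cong₂ (λ b n → (if b then 1 else 0) + n) (iso (there (here refl)) (here refl)) (des-Inv (q ∷ z) (Iso-⊆ there iso))

wt-Inv : Inv wt
wt-Inv [] iso = refl
wt-Inv (p ∷ z) iso = cong suc (des-Inv (p ∷ z) iso)

incr-Inv : Inv incr
incr-Inv [] iso = refl
incr-Inv (p ∷ []) iso = refl
incr-Inv (p ∷ q ∷ z) iso = cong₂ _∧_ (iso (here refl) (there (here refl))) (incr-Inv (q ∷ z) (Iso-⊆ there iso))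

-- Convolutions as shifts

sh-shⁿ : ∀ n p → shⁿ n (sh p) ≈ᴾ sh (shⁿ n p)
sh-shⁿ zero p d = refl
sh-shⁿ (suc n) p d = sh-shⁿ n (sh p) d

sum-zero : ∀ (g : ℕ → ℤ) is → (∀ i → g i ≡ + 0) → sumℤ (map g is) ≡ + 0
sum-zero g [] g≡0 = refl
sum-zero g (i ∷ is) g≡0 = trans (cong₂ ℤ._+_ (g≡0 i) (sum-zero g is g≡0)) refl

-- The left factor is the coefficient sequence of a power of `y`, or zero, so the Cauchy product
-- collapses to a shift.
sum-pick : ∀ b m p d → sumℤ (map (λ e → + (if b ∧ (m ≡ᵇ e) then 1 else 0) ℤ.* p (d ∸ e)) (upTo (suc d))) ≡ b ▸ shⁿ m p d
sum-pick false m p d = sum-zero _ (upTo (suc d)) (λ e → ℤₚ.*-zeroˡ (p (d ∸ e)))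
sum-pick true zero p d = begin
  sumℤ (map g (upTo (suc d)))                       ≡⟨ sum-upTo g d ⟩
  g 0 ℤ.+ sumℤ (map (g ∘ suc) (upTo d))             ≡⟨ cong₂ ℤ._+_ (ℤₚ.*-identityˡ (p d)) (sum-zero _ (upTo d) λ e → ℤₚ.*-zeroˡ (p (d ∸ suc e))) ⟩
  p d ℤ.+ + 0                                       ≡⟨ ℤₚ.+-identityʳ (p d) ⟩
  p d                                               ∎
  where
  open ≡-Reasoning
  g : ℕ → ℤ
  g e = + (if true ∧ (0 ≡ᵇ e) then 1 else 0) ℤ.* p (d ∸ e)
sum-pick true (suc m) p zero = trans (trans (ℤₚ.+-identityʳ (+ 0 ℤ.* p 0)) (ℤₚ.*-zeroˡ (p 0))) (sym (sh-shⁿ m p 0))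
sum-pick true (suc m) p (suc d) = begin
  sumℤ (map g (upTo (suc (suc d))))                 ≡⟨ sum-upTo g (suc d) ⟩
  g 0 ℤ.+ sumℤ (map (g ∘ suc) (upTo (suc d)))       ≡⟨ cong₂ ℤ._+_ (ℤₚ.*-zeroˡ (p (suc d))) (sum-pick true m p d) ⟩
  + 0 ℤ.+ shⁿ m p d                                 ≡⟨ ℤₚ.+-identityˡ _ ⟩
  shⁿ m p d                                         ≡⟨ sh-shⁿ m p (suc d) ⟨
  shⁿ m (sh p) (suc d)                              ∎
  where
  open ≡-Reasoning
  g : ℕ → ℤ
  g e = + (if true ∧ (suc m ≡ᵇ e) then 1 else 0) ℤ.* p (suc d ∸ e)

yᴾ-* : ∀ p → (yᴾ *ᴾ p) ≈ᴾ sh p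
yᴾ-* p d = trans (cong sumℤ (Lₚ.map-cong (λ e → cong (ℤ._* p (d ∸ e)) (y≡ e)) (upTo (suc d)))) (sum-pick true 1 p d)
  where
  y≡ : ∀ e → yᴾ e ≡ + (if true ∧ (1 ≡ᵇ e) then 1 else 0)
  y≡ zero = refl
  y≡ (suc zero) = refl
  y≡ (suc (suc e)) = refl

sum-cong-< : ∀ {g h : ℕ → ℤ} n → (∀ i → i < n → g i ≡ h i) → sumℤ (map g (upTo n)) ≡ sumℤ (map h (upTo n))
sum-cong-< n eq = cong sumℤ (Lₚ.map-cong-local (All.tabulate (λ {i} i∈ → eq i (∈-upTo⁻ i∈))))

-- U as the weighted number of tiled permutations

module Inverse (j s : ℕ) (k≤s : suc (suc j) ≤ s) where
  open Matches j s
  open Endings j s k≤s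
  open Bricks j s k≤s

  tilings-Inv : ∀ d → Inv (λ w → tilings w d)
  tilings-Inv d [] iso = refl
  tilings-Inv d (p ∷ z) iso = start-Iso iso short-length (here refl) (All.tabulate there) d

  F : ℕ → Poly
  F n d = ∑ n (λ w → tilings w d)

  term-Invˡ : ∀ d v → Inv (λ u → term d u v)
  term-Invˡ d v z iso = cong₂ (λ b n → not b ▸ shⁿ n (tilings v) d) (hasMatch-Inv k s z iso) (wt-Inv z iso)

  term-Invʳ : ∀ d u → Inv (term d u)
  term-Invʳ d u z iso = cong (not (hasMatch k s u) ▸_) (shⁿ-cong (wt u) (λ d → tilings-Inv d z iso) d)

  indicator : ℕ → Word → ℕ
  indicator e u = if not (hasMatch k s u) ∧ (suc (des u) ≡ᵇ e) then 1 else 0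

  A≡∑ : ∀ i e → A k s i e ≡ ∑ i (λ u → + indicator e u)
  A≡∑ i e = sum-perms i (indicator e)
    (λ z iso → cong₂ (λ b n → if not b ∧ (suc n ≡ᵇ e) then 1 else 0) (hasMatch-Inv k s z iso) (des-Inv z iso))

  A*F : ∀ i l d → (A k s (suc i) *ᴾ F l) d ≡ ∑ (suc i) (λ u → ∑ l (term d u))
  A*F i l d = sym (begin
    ∑ (suc i) (λ u → ∑ l (term d u))
      ≡⟨ ∑-cong (suc i) (λ u |u| _ → ∑-ext l (expand u |u|)) ⟩
    ∑ (suc i) (λ u → ∑ l (λ v → sumℤ (map (λ e → + indicator e u ℤ.* tilings v (d ∸ e)) (upTo (suc d)))))
      ≡⟨ ∑-ext (suc i) (λ u → trans (∑-sumℤ l (λ e v → + indicator e u ℤ.* tilings v (d ∸ e)) (upTo (suc d)))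
           (cong sumℤ (Lₚ.map-cong (λ e → trans (∑-* (+ indicator e u) l (λ v → tilings v (d ∸ e)))
              (ℤₚ.*-comm (+ indicator e u) (F l (d ∸ e)))) (upTo (suc d))))) ⟩
    ∑ (suc i) (λ u → sumℤ (map (λ e → F l (d ∸ e) ℤ.* + indicator e u) (upTo (suc d))))
      ≡⟨ ∑-sumℤ (suc i) (λ e u → F l (d ∸ e) ℤ.* + indicator e u) (upTo (suc d)) ⟩
    sumℤ (map (λ e → ∑ (suc i) (λ u → F l (d ∸ e) ℤ.* + indicator e u)) (upTo (suc d)))
      ≡⟨ cong sumℤ (Lₚ.map-cong (λ e → trans (∑-* (F l (d ∸ e)) (suc i) (λ u → + indicator e u))
           (trans (ℤₚ.*-comm (F l (d ∸ e)) _) (cong (ℤ._* F l (d ∸ e)) (sym (A≡∑ (suc i) e))))) (upTo (suc d))) ⟩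
    (A k s (suc i) *ᴾ F l) d ∎)
    where
    open ≡-Reasoning
    expand : ∀ u → length u ≡ suc i → ∀ v →
             term d u v ≡ sumℤ (map (λ e → + indicator e u ℤ.* tilings v (d ∸ e)) (upTo (suc d)))
    -- Only for nonempty `u` is `wt u` equal to `suc (des u)`, the exponent counted by `A`.
    expand u@(_ ∷ _) _ v = sym (sum-pick (not (hasMatch k s u)) (suc (des u)) (tilings v) d)

  -- The splitting with empty prefix contributes `F (suc n)` itself. By `∑-split` the others give
  -- the binomial convolution, and by `sum-term` everything adds up to zero.
  F-convolution : ∀ n d → F (suc n) d ≡
    ℤ.- sumℤ (map (λ i → + (suc n C suc i) ℤ.* (A k s (suc i) *ᴾ F (n ∸ i)) d) (upTo (suc n)))
  F-convolution n d = inverse (F (suc n) d) _ (begin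
    F (suc n) d ℤ.+ sumℤ (map (λ i → + (suc n C suc i) ℤ.* (A k s (suc i) *ᴾ F (n ∸ i)) d) (upTo (suc n)))
      ≡⟨ cong (ℤ._+_ (F (suc n) d)) (sum-cong-< (suc n) λ { i (s≤s i≤n) → trans
            (cong (ℤ._*_ (+ (suc n C suc i))) (A*F i (n ∸ i) d))
            (subst (λ m → + (m C suc i) ℤ.* ∑ (suc i) (λ u → ∑ (n ∸ i) (term d u)) ≡ ∑ m (split (suc i) (term d))) (cong suc (ℕₚ.m+[n∸m]≡n i≤n))
              (sym (∑-split (suc i) (n ∸ i) (term d) (term-Invˡ d) (term-Invʳ d)))) }) ⟩
    ∑ (suc n) (split 0 (term d)) ℤ.+ sumℤ (map (λ i → ∑ (suc n) (split (suc i) (term d))) (upTo (suc n)))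
      ≡⟨ sum-upTo (λ i → ∑ (suc n) (split i (term d))) (suc n) ⟨
    sumℤ (map (λ i → ∑ (suc n) (split i (term d))) (upTo (suc (suc n))))
      ≡⟨ ∑-sumℤ (suc n) (λ i → split i (term d)) (upTo (suc (suc n))) ⟨
    ∑ (suc n) (λ w → sumℤ (map (λ i → split i (term d) w) (upTo (suc (suc n)))))
      ≡⟨ ∑-zero (suc n) (λ w |w| uw → sum-term n w |w| uw d) ⟩
    + 0 ∎)
    where
    open ≡-Reasoning
    inverse : ∀ a b → a ℤ.+ b ≡ + 0 → a ≡ ℤ.- b
    inverse a b a+b≡0 = trans (rearrange a b) (trans (cong (ℤ._- b) a+b≡0) (ℤₚ.+-identityˡ (ℤ.- b)))
      where
      rearrange : ∀ a b → a ≡ a ℤ.+ b ℤ.- b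
      rearrange = solve-∀

  nth-table : ∀ n i → i ≤ n → nthᴾ (table k s n) i ≡ U k s (n ∸ i)
  nth-table n zero _ = refl
  nth-table (suc n) (suc i) (s≤s i≤n) = nth-table n i i≤n

  -- Both sequences obey the same convolution, which expresses each term by all smaller ones; the
  -- bound `n` makes this strong induction structural.
  U≈F-≤ : ∀ n m → m ≤ n → U k s m ≈ᴾ F m
  U≈F-≤ n zero _ d = refl
  U≈F-≤ (suc n) (suc m) (s≤s m≤n) d = trans
    (cong ℤ.-_ (sum-cong-< (suc m) λ { i (s≤s i≤m) → cong (ℤ._*_ (+ (suc m C suc i)))
      (cong sumℤ (Lₚ.map-cong (λ e → cong (ℤ._*_ (A k s (suc i) e))
        (trans (cong (λ p → p (d ∸ e)) (nth-table m i i≤m))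
               (U≈F-≤ n (m ∸ i) (ℕₚ.≤-trans (ℕₚ.m∸n≤m m i) m≤n) (d ∸ e)))) (upTo (suc d)))) }))
    (sym (F-convolution m d))

  U≈F : ∀ n → U k s n ≈ᴾ F n
  U≈F n = U≈F-≤ n n ℕₚ.≤-refl

-- Summands that force the inserted letter to come first

ins-mid-zero : ∀ x w f → (∀ u v → f (u ++ x ∷ v) ≡ + 0) → ins x w f ≡ + 0
ins-mid-zero x [] f f≡0 = f≡0 [] []
ins-mid-zero x (y ∷ w) f f≡0 =
  cong₂ ℤ._+_ (f≡0 [] (y ∷ w)) (ins-mid-zero x w (f ∘ (y ∷_)) (λ u v → f≡0 (y ∷ u) v))

ins-head : ∀ x w f → (∀ y u v → f (y ∷ u ++ x ∷ v) ≡ + 0) → ins x w f ≡ f (x ∷ w)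
ins-head x [] f f≡0 = refl
ins-head x (y ∷ w) f f≡0 =
  trans (cong (ℤ._+_ (f (x ∷ y ∷ w))) (ins-mid-zero x w (f ∘ (y ∷_)) (f≡0 y))) (ℤₚ.+-identityʳ _)

ins-▸ : ∀ b x w f → ins x w (λ v → b ▸ f v) ≡ b ▸ ins x w f
ins-▸ false x w f = ins-zero x w (λ _ _ → refl)
ins-▸ true x w f = refl

∑-▸ : ∀ b n f → ∑ n (λ w → b ▸ f w) ≡ b ▸ ∑ n f
∑-▸ false n f = ∑-zero n (λ _ _ _ → refl)
∑-▸ true n f = refl

incr-mid-zero : ∀ y u v → incr (y ∷ u ++ 0 ∷ v) ≡ false
incr-mid-zero y [] v = refl
incr-mid-zero y (x ∷ u) v rewrite incr-mid-zero x u v with y <ᵇ x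
... | false = refl
... | true = refl

-- A minimum inserted anywhere but in front creates a descent, so one permutation survives at each
-- step.
∑-incr : ∀ n e → ∑ n (λ u → incr u ▸ e) ≡ e
∑-incr zero e = refl
∑-incr (suc n) e = trans
  (∑-ext n (λ w → trans (ins-head 0 (map suc w) (λ u → incr u ▸ e) (λ y u v → cong (_▸ e) (incr-mid-zero y u v)))
                        (cong (_▸ e) (incr-0∷ w))))
  (∑-incr n e)
  where
  incr-0∷ : ∀ w → incr (0 ∷ map suc w) ≡ incr w
  incr-0∷ [] = refl
  incr-0∷ (x ∷ w) = Inv-map-suc incr incr-Inv (x ∷ w)

-- Deleting minimal letters from tiled permutations

module Recurrence (j s : ℕ) (k≤s : suc (suc j) ≤ s) where
  open Matches j s
  open Endings j s k≤s
  open Bricks j s k≤s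
  open Inverse j s k≤s

  -- The minimal letter of a tiled word

  win-zero : ∀ i r → win i r 0 ≡ false
  win-zero i [] = refl
  win-zero i (c ∷ []) = refl
  win-zero zero (c ∷ c′ ∷ r) with 0 <ᵇ c
  ... | false = refl
  ... | true = refl
  win-zero (suc i) (c ∷ c′ ∷ r) rewrite win-zero i (c′ ∷ r) with c′ <ᵇ c
  ... | false = refl
  ... | true = refl

  -- Past the first letter, `0` could be reached only by an ascent or through a window, and a window
  -- would need `u₀ < 0`.
  brick-zero : ∀ ok c r u v d → brick ok (c ∷ r) (u ++ 0 ∷ v) d ≡ + 0
  start-zero : ∀ ok x u v d → start ok x (u ++ 0 ∷ v) d ≡ + 0
  brick-zero ok c r [] v d rewrite win-zero j (c ∷ r) = trans (ℤₚ.+-identityʳ _) (▸-zero (ok (c ∷ r)))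
  brick-zero ok c r (x ∷ u) v d
    rewrite start-zero short x u v d | start-zero long x u v d | brick-zero ok x (c ∷ r) u v d
          | ▸-zero (win j (c ∷ r) x) with c <ᵇ x | ok (c ∷ r)
  ... | false | false = refl
  ... | false | true = refl
  ... | true | false = refl
  ... | true | true = refl
  start-zero ok x u v zero = refl
  start-zero ok x u v (suc d) = cong ℤ.-_ (brick-zero ok x [] u v d)

  insMin-tilings : ∀ w d → insMin (λ v → tilings v d) w ≡ start short 0 (map suc w) d
  insMin-tilings w d = ins-head 0 (map suc w) (λ v → tilings v d) (λ y u v → start-zero short y u v d)

  -- The length of the first brick

  exact : ℕ → Word → Bool
  exact m w = length w ≡ᵇ m

  range : ℕ → ℕ → ℕ → Bool
  range lo l n = not (n <ᵇ lo) ∧ (n <ᵇ lo + l)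

  range-zero : ∀ lo n → range lo 0 n ≡ false
  range-zero lo n rewrite ℕₚ.+-identityʳ lo with n <ᵇ lo
  ... | false = refl
  ... | true = refl

  range-suc : ∀ lo l n e → range lo (suc l) n ▸ e ≡ ((n ≡ᵇ lo) ▸ e) ℤ.+ (range (suc lo) l n ▸ e)
  range-suc lo l n e rewrite ℕₚ.+-suc lo l with ℕₚ.<-cmp n lo
  ... | tri< n<lo n≢lo _ rewrite <ᵇ-true n<lo | ≡ᵇ-false n≢lo | <ᵇ-true (ℕₚ.m<n⇒m<1+n n<lo) = refl
  ... | tri≈ _ refl _
    rewrite <ᵇ-false {n} ℕₚ.≤-refl | ≡ᵇ-true n | <ᵇ-true (ℕₚ.n<1+n n) | <ᵇ-true {n} {suc (n + l)} (s≤s (ℕₚ.m≤m+n n l)) =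
    sym (ℤₚ.+-identityʳ e)
  ... | tri> _ n≢lo lo<n rewrite <ᵇ-false (ℕₚ.<⇒≤ lo<n) | ≡ᵇ-false n≢lo | <ᵇ-false {n} {suc lo} lo<n =
    sym (ℤₚ.+-identityˡ _)

  brick-none : ∀ ok → (∀ r → ok r ≡ false) → ∀ r w d → brick ok r w d ≡ + 0
  brick-none ok none r [] d rewrite none r = refl
  brick-none ok none r (x ∷ w) d rewrite none r | brick-none ok none (x ∷ r) w d = trans (ℤₚ.+-identityˡ _) (▸-zero (asc r x))

  brick-range : ∀ lo l r w d → brick (range lo l ∘ length) r w d ≡ sumℤ (map (λ i → brick (exact (lo + i)) r w d) (upTo l))
  brick-range lo zero r w d = brick-none _ (λ r → range-zero lo (length r)) r w d
  brick-range lo (suc l) r w d = begin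
    brick (range lo (suc l) ∘ length) r w d
      ≡⟨ brick-ok-+ (λ r e → range-suc lo l (length r) e) r w d ⟩
    brick (exact lo) r w d ℤ.+ brick (range (suc lo) l ∘ length) r w d
      ≡⟨ cong₂ ℤ._+_ (cong (λ m → brick (exact m) r w d) (sym (ℕₚ.+-identityʳ lo))) (trans (brick-range (suc lo) l r w d)
           (cong sumℤ (Lₚ.map-cong (λ i → cong (λ m → brick (exact m) r w d) (sym (ℕₚ.+-suc lo i))) (upTo l)))) ⟩
    brick (exact (lo + 0)) r w d ℤ.+ sumℤ (map (λ i → brick (exact (lo + suc i)) r w d) (upTo l))
      ≡⟨ sum-upTo (λ i → brick (exact (lo + i)) r w d) l ⟨
    sumℤ (map (λ i → brick (exact (lo + i)) r w d) (upTo (suc l))) ∎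
    where open ≡-Reasoning

  -- Tiled permutations of size n + 1 whose first brick has length m; the weight -y of that brick is left out.
  Q : ℕ → ℕ → Poly
  Q m n d = ∑ n (λ w → brick (exact m) (0 ∷ []) (map suc w) d)

  ∑-small : ∀ n d → ∑ n (λ w → brick small (0 ∷ []) (map suc w) d) ≡ sumℤ (map (λ i → Q (1 + i) n d) (upTo (suc j)))
  ∑-small n d = trans
    (∑-ext n (λ w → trans (brick-ok-cong {small} {range 1 (suc j) ∘ length} (λ _ _ → refl) 0 [] (map suc w) d) (brick-range 1 (suc j) (0 ∷ []) (map suc w) d)))
    (∑-sumℤ n (λ i w → brick (exact (1 + i)) (0 ∷ []) (map suc w) d) (upTo (suc j)))

  ∑-long : ∀ n d → ∑ n (λ w → brick long (0 ∷ []) (map suc w) d) ≡ sumℤ (map (λ p → Q (k + p) n d) (upTo (suc (s ∸ k))))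
  ∑-long n d = trans
    (∑-ext n (λ w → trans (brick-ok-cong {long} {range k (suc (s ∸ k)) ∘ length}
        (λ c r → cong (λ m → not (length (c ∷ r) <ᵇ k) ∧ (length (c ∷ r) <ᵇ m)) 1+s≡) 0 [] (map suc w) d)
      (brick-range k (suc (s ∸ k)) (0 ∷ []) (map suc w) d)))
    (∑-sumℤ n (λ p w → brick (exact (k + p)) (0 ∷ []) (map suc w) d) (upTo (suc (s ∸ k))))
    where
    1+s≡ : suc s ≡ k + suc (s ∸ k)
    1+s≡ = sym (trans (ℕₚ.+-suc k (s ∸ k)) (cong suc (ℕₚ.m+[n∸m]≡n k≤s)))

  -- Tiled permutations of size l + 1 whose first brick has length at least k.
  G : ℕ → Poly
  G l d = ∑ l (λ w → start long 0 (map suc w) d)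

  F-suc : ∀ n d → F (suc n) d ≡ ∑ n (λ w → start short 0 (map suc w) d)
  F-suc n d = ∑-ext n (λ w → insMin-tilings w d)

  F-zero : ∀ n → F (suc n) 0 ≡ + 0
  F-zero n = trans (F-suc n 0) (∑-zero n (λ _ _ _ → refl))

  ∑-short : ∀ n d → ∑ n (λ w → brick short (0 ∷ []) (map suc w) d) ≡
    ∑ n (λ w → brick small (0 ∷ []) (map suc w) d) ℤ.+ ∑ n (λ w → brick long (0 ∷ []) (map suc w) d)
  ∑-short n d = trans (∑-ext n (λ w → brick-ok-+ short-split (0 ∷ []) (map suc w) d)) (∑-+ n _ _)

  F-Q : ∀ n d → F (suc n) (suc d) ≡
    ℤ.- (sumℤ (map (λ i → Q (1 + i) n d) (upTo (suc j))) ℤ.+ sumℤ (map (λ p → Q (k + p) n d) (upTo (suc (s ∸ k)))))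
  F-Q n d = trans (F-suc n (suc d)) (trans (∑-neg n _)
    (cong ℤ.-_ (trans (∑-short n d) (cong₂ ℤ._+_ (∑-small n d) (∑-long n d)))))

  -- `long` is `short` without `small`. The factor `-y` of the first brick, absent from `Q`, makes
  -- the correction positive; this is the origin of the inner sum over `a`.
  G-F : ∀ l d → G l d ≡ F (suc l) d ℤ.+ sh (λ d → sumℤ (map (λ i → Q (1 + i) l d) (upTo (suc j)))) d
  G-F l zero = trans (∑-zero l (λ _ _ _ → refl)) (sym (trans (ℤₚ.+-identityʳ _) (F-zero l)))
  G-F l (suc d) = begin
    G l (suc d)                                        ≡⟨ ∑-neg l _ ⟩
    ℤ.- L                                              ≡⟨ rearrange S L ⟩
    ℤ.- (S ℤ.+ L) ℤ.+ S                                ≡⟨ cong (λ e → ℤ.- e ℤ.+ S) (∑-short l d) ⟨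
    ℤ.- ∑ l (λ w → brick short (0 ∷ []) (map suc w) d) ℤ.+ S
      ≡⟨ cong₂ ℤ._+_ (sym (trans (F-suc l (suc d)) (∑-neg l _))) (∑-small l d) ⟩
    F (suc l) (suc d) ℤ.+ sumℤ (map (λ i → Q (1 + i) l d) (upTo (suc j))) ∎
    where
    open ≡-Reasoning
    S = ∑ l (λ w → brick small (0 ∷ []) (map suc w) d)
    L = ∑ l (λ w → brick long (0 ∷ []) (map suc w) d)
    rearrange : ∀ a b → ℤ.- b ≡ ℤ.- (a ℤ.+ b) ℤ.+ a
    rearrange = solve-∀

  brick-exceeded : ∀ m r w d → m < length r → brick (exact m) r w d ≡ + 0
  brick-exceeded m r [] d m< rewrite ≡ᵇ-false (≢-sym (ℕₚ.<⇒≢ m<)) = refl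
  brick-exceeded m r (x ∷ w) d m<
    rewrite ≡ᵇ-false (≢-sym (ℕₚ.<⇒≢ m<)) | brick-exceeded m (x ∷ r) w d (ℕₚ.m<n⇒m<1+n m<) =
    trans (ℤₚ.+-identityˡ _) (▸-zero (asc r x))

  -- The boundary after the one-letter brick `0` is always an ascent, so the rest is an arbitrary
  -- tiling.
  Q-one : ∀ n d → Q 1 n d ≡ F n d
  Q-one n d = ∑-ext n λ w → trans (point w) (Inv-map-suc (λ w → tilings w d) (tilings-Inv d) w)
    where
    point : ∀ w → brick (exact 1) (0 ∷ []) (map suc w) d ≡ tilings (map suc w) d
    point [] = refl
    point (x ∷ w) rewrite brick-exceeded 1 (suc x ∷ 0 ∷ []) (map suc w) d ℕₚ.≤-refl = ℤₚ.+-identityʳ _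

  first : ℕ → ℕ → Word → ℤ
  first m d [] = + 0
  first m d (x ∷ w) = brick (exact m) (x ∷ []) w d

  first-Inv : ∀ m d → Inv (first m d)
  first-Inv m d [] iso = refl
  first-Inv m d (p ∷ z) iso =
    brick-Iso iso (λ zr → cong (_≡ᵇ m) (length-proj zr)) (here refl ∷ []) (All.tabulate there) d

  ∑-first : ∀ m n d → ∑ (suc n) (λ w → first m d (map suc w)) ≡ Q m n d
  ∑-first m n d = trans (∑-ext (suc n) (Inv-map-suc (first m d) (first-Inv m d)))
    (∑-ext n (λ w → ins-head 0 (map suc w) (first m d) (λ y u v → brick-zero (exact m) y [] u v d)))

  -- Removing the minimal letter 0 in front of the first brick

  win-∷ʳ0 : ∀ i r x → length r ≢ suc i → win i (r ++ 0 ∷ []) x ≡ win i r x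
  win-∷ʳ0 i [] x _ = refl
  win-∷ʳ0 zero (c ∷ []) x ≢ = ⊥-elim (≢ refl)
  win-∷ʳ0 (suc i) (c ∷ []) x _ with 0 <ᵇ c
  ... | false = refl
  ... | true = refl
  win-∷ʳ0 zero (c ∷ c′ ∷ r) x _ = refl
  win-∷ʳ0 (suc i) (c ∷ c′ ∷ r) x ≢ = cong ((c′ <ᵇ c) ∧_) (win-∷ʳ0 i (c′ ∷ r) x (≢ ∘ cong suc))

  exact-∷ʳ0 : ∀ m c r → exact (suc m) (c ∷ r ++ 0 ∷ []) ≡ exact m (c ∷ r)
  exact-∷ʳ0 m c r = cong (_≡ᵇ m) (trans (Lₚ.length-++ r) (ℕₚ.+-comm (length r) 1))

  -- A window consists of the last `k` letters of a brick. The leading `0` can belong to it only if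
  -- the brick has length exactly `k` with `0` included.
  brick-∷ʳ0 : ∀ m → m ≢ suc j → ∀ c r w d → brick (exact (suc m)) (c ∷ r ++ 0 ∷ []) w d ≡ brick (exact m) (c ∷ r) w d
  brick-∷ʳ0 m m≢ c r [] d = cong (_▸ 1ᴾ d) (exact-∷ʳ0 m c r)
  brick-∷ʳ0 m m≢ c r (x ∷ w) d = cong₂ ℤ._+_ now (cong ((c <ᵇ x) ▸_) (brick-∷ʳ0 m m≢ x (c ∷ r) w d))
    where
    now : exact (suc m) (c ∷ r ++ 0 ∷ []) ▸ next (c ∷ r ++ 0 ∷ []) x w d ≡ exact m (c ∷ r) ▸ next (c ∷ r) x w d
    now rewrite exact-∷ʳ0 m c r with suc (length r) ≡ᵇ m in eq
    ... | false = refl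
    ... | true = next-cong c (r ++ 0 ∷ []) r x w d (win-∷ʳ0 j (c ∷ r) x (m≢ ∘ trans (sym (ℕₚ.≡ᵇ⇒≡ (suc (length r)) m (from T-≡ eq)))))

  -- The first brick has length k once 0 is prepended and is followed by a descent:
  -- i letters of it remain to be read, c is the last letter read and f the first.
  extra : ℕ → ℕ → ℕ → ℕ → Word → ℤ
  extra d i c f [] = + 0
  extra d zero c f (x ∷ w) = (x <ᵇ f) ▸ start long x w d
  extra d (suc i) c f (x ∷ w) = (c <ᵇ x) ▸ extra d i x f w

  -- The window is now the whole brick, with `u₀ = 0` and `u₁ = f`, and its lower inequality is
  -- automatic.
  Seg-win0 : ∀ {f n q q′} → Seg [] f n q q′ → ∀ x → win n (q ++ 0 ∷ []) (suc x) ≡ (suc x <ᵇ f)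
  Seg-win0 {f} (one _) x with suc x <ᵇ f
  ... | false = refl
  ... | true = refl
  Seg-win0 (ext seg c<y) x rewrite <ᵇ-true c<y = Seg-win0 seg x

  Seg-first≤ : ∀ {f n c q q′} → Seg [] f n (c ∷ q) q′ → f ≤ c
  Seg-first≤ (one _) = ℕₚ.≤-refl
  Seg-first≤ (ext seg c<y) = ℕₚ.≤-trans (Seg-first≤ seg) (ℕₚ.<⇒≤ c<y)

  Seg-length₁ : ∀ {f n q q′} → Seg [] f n q q′ → length q ≡ suc n
  Seg-length₁ (one _) = refl
  Seg-length₁ (ext seg _) = cong suc (Seg-length₁ seg)

  win-short : ∀ i r x → length r ≡ suc i → win i r x ≡ false
  win-short zero (c ∷ []) x _ = refl
  win-short (suc i) (c ∷ c′ ∷ r) x eq rewrite win-short i (c′ ∷ r) x (ℕₚ.suc-injective eq) with c′ <ᵇ c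
  ... | false = refl
  ... | true = refl

  -- Without `0` the completed brick has only `k - 1` letters, so by `win-short` no descent may
  -- follow it; the descents gained by adding `0` are those in `extra`. In `i + n ≡ j`, the run
  -- already has `n + 1` of these `k - 1` letters and lacks `i`.
  brick-extra : ∀ i {n f c q} → i + n ≡ j → Seg [] f n (c ∷ q) (c ∷ q) → ∀ w d →
    brick (exact k) (c ∷ q ++ 0 ∷ []) (map suc w) d ≡ brick (exact (suc j)) (c ∷ q) (map suc w) d ℤ.+ extra d i c f (map suc w)
  brick-extra i {c = c} {q} eq seg [] d =
    trans (cong (_▸ 1ᴾ d) (exact-∷ʳ0 (suc j) c q)) (sym (ℤₚ.+-identityʳ _))
  brick-extra zero {f = f} {c} {q} refl seg (x ∷ w) d
    rewrite exact-∷ʳ0 (suc j) c q | ℕₚ.suc-injective (Seg-length₁ seg) | ≡ᵇ-true j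
          | brick-exceeded k (suc x ∷ c ∷ q ++ 0 ∷ []) (map suc w) d
              (ℕₚ.≤-reflexive (cong suc (sym (trans (cong suc (trans (Lₚ.length-++ q) (ℕₚ.+-comm (length q) 1))) (cong suc (Seg-length₁ seg))))))
          | brick-exceeded (suc j) (suc x ∷ c ∷ q) (map suc w) d (ℕₚ.≤-reflexive (cong suc (sym (Seg-length₁ seg))))
          | Seg-win0 seg x | win-short j (c ∷ q) (suc x) (Seg-length₁ seg) with c <ᵇ suc x in eq
  ... | true rewrite <ᵇ-false (ℕₚ.≤-trans (Seg-first≤ seg) (ℕₚ.<⇒≤ (ℕₚ.<ᵇ⇒< c (suc x) (from T-≡ eq)))) =
    sym (ℤₚ.+-identityʳ _)
  ... | false = ℤₚ.+-comm ((suc x <ᵇ f) ▸ start long (suc x) (map suc w) d) (+ 0)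
  brick-extra (suc i) {n} {f} {c} {q} eq seg (x ∷ w) d
    rewrite exact-∷ʳ0 (suc j) c q | ℕₚ.suc-injective (Seg-length₁ seg) | ≡ᵇ-false (ℕₚ.<⇒≢ (subst (n <_) eq (s≤s (ℕₚ.m≤n+m n i)))) with c <ᵇ suc x in lt
  ... | false = refl
  ... | true = trans (ℤₚ.+-identityˡ _) (trans
      (brick-extra i (trans (ℕₚ.+-suc i n) eq) (ext seg (ℕₚ.<ᵇ⇒< c (suc x) (from T-≡ lt))) w d)
      (cong (ℤ._+ extra d i (suc x) f (map suc w)) (sym (ℤₚ.+-identityˡ (brick (exact (suc j)) (suc x ∷ c ∷ q) (map suc w) d)))))

  extraWord : ℕ → Word → ℤ
  extraWord d [] = + 0
  extraWord d (x ∷ w) = extra d j x x w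

  extra-Iso : ∀ {z} → Iso z → ∀ d i {c f zw} → c ∈ z → f ∈ z → All (_∈ z) zw →
              extra d i (proj₁ c) (proj₁ f) (map proj₁ zw) ≡ extra d i (proj₂ c) (proj₂ f) (map proj₂ zw)
  extra-Iso iso d i c∈ f∈ [] = refl
  extra-Iso iso d zero c∈ f∈ (x∈ ∷ w∈) = cong₂ _▸_ (iso x∈ f∈) (start-Iso iso long-length x∈ w∈ d)
  extra-Iso iso d (suc i) c∈ f∈ (x∈ ∷ w∈) = cong₂ _▸_ (iso c∈ x∈) (extra-Iso iso d i x∈ f∈ w∈)

  extraWord-Inv : ∀ d → Inv (extraWord d)
  extraWord-Inv d [] iso = refl
  extraWord-Inv d (p ∷ z) iso = extra-Iso iso d j (here refl) (here refl) (All.tabulate there)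

  extra-f0 : ∀ d i c w → extra d i c 0 w ≡ + 0
  extra-f0 d i c [] = refl
  extra-f0 d zero c (x ∷ w) = refl
  extra-f0 d (suc i) c (x ∷ w) = trans (cong ((c <ᵇ x) ▸_) (extra-f0 d i x w)) (▸-zero (c <ᵇ x))

  climbs : ℕ → ℕ → Word → Bool
  climbs zero c w = true
  climbs (suc i) c [] = false
  climbs (suc i) c (x ∷ w) = (c <ᵇ x) ∧ climbs i x w

  -- The position of the next minimum is forced: earlier it would break the increase of the first
  -- brick, later `start-zero` excludes it, so it heads the second brick.
  ins-extra : ∀ d i c f w → ins 0 w (extra d i c (suc f)) ≡ climbs i c w ▸ start long 0 (drop i w) d
  ins-extra d zero c f [] = refl
  ins-extra d zero c f (x ∷ w) = trans
    (cong (ℤ._+_ (start long 0 (x ∷ w) d)) (trans (ins-▸ (x <ᵇ suc f) 0 w (λ v → start long x v d))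
      (trans (cong ((x <ᵇ suc f) ▸_) (ins-mid-zero 0 w (λ v → start long x v d) (λ u v → start-zero long x u v d)))
             (▸-zero (x <ᵇ suc f)))))
    (ℤₚ.+-identityʳ _)
  ins-extra d (suc i) c f [] = refl
  ins-extra d (suc i) c f (x ∷ w) = trans (ℤₚ.+-identityˡ _) (trans (ins-▸ (c <ᵇ x) 0 w (extra d i x (suc f)))
    (trans (cong ((c <ᵇ x) ▸_) (ins-extra d i x f w)) (sym (∧-▸ (c <ᵇ x) (climbs i x w) _))))

  climbs≡incr : ∀ i c w → i ≤ length w → climbs i c w ≡ incr (c ∷ take i w)
  climbs≡incr zero c w _ = refl
  climbs≡incr (suc i) c (x ∷ w) (s≤s i≤) = cong ((c <ᵇ x) ∧_) (climbs≡incr i x w i≤)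

  climbs-false : ∀ i c w → length w < i → climbs i c w ≡ false
  climbs-false (suc i) c [] _ = refl
  climbs-false (suc i) c (x ∷ w) (s≤s w<) rewrite climbs-false i x w w< with c <ᵇ x
  ... | false = refl
  ... | true = refl

  insMin-extra : ∀ d x w → insMin (extraWord d) (x ∷ w) ≡ climbs j (suc x) (map suc w) ▸ start long 0 (drop j (map suc w)) d
  insMin-extra d x w = trans
    (cong (ℤ._+ ins 0 (map suc w) (extra d j (suc x) (suc x))) (extra-f0 d j 0 (suc x ∷ map suc w)))
    (trans (ℤₚ.+-identityˡ _) (ins-extra d j (suc x) x (map suc w)))

  ∑-extra-< : ∀ n d → n < suc j → ∑ (suc n) (extraWord d) ≡ + 0
  ∑-extra-< n d n<k = ∑-zero n zeroes
    where
    zeroes : ∀ w → length w ≡ n → Unique w → insMin (extraWord d) w ≡ + 0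
    zeroes [] _ _ = refl
    zeroes (x ∷ w) refl _ = trans (insMin-extra d x w)
      (cong (_▸ start long 0 (drop j (map suc w)) d)
        (climbs-false j (suc x) (map suc w) (subst (_< j) (sym (Lₚ.length-map suc w)) (ℕₚ.≤-pred n<k))))

  -- With the two smallest letters gone, `∑-split` separates the other `k - 1` letters of the first
  -- brick from the rest; `∑-incr` leaves one arrangement of the former.
  ∑-extra-+ : ∀ l d → ∑ (suc (suc j + l)) (extraWord d) ≡ + ((suc j + l) C suc j) ℤ.* G l d
  ∑-extra-+ l d = begin
    ∑ (suc j + l) (insMin (extraWord d))          ≡⟨ ∑-cong (suc j + l) (λ w |w| _ → point w |w|) ⟩
    ∑ (suc j + l) (split (suc j) h)               ≡⟨ ∑-split (suc j) l h h-Invˡ h-Invʳ ⟩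
    + ((suc j + l) C suc j) ℤ.* ∑ (suc j) (λ u → ∑ l (h u))
      ≡⟨ cong (ℤ._*_ (+ ((suc j + l) C suc j))) (trans (∑-ext (suc j) (λ u → ∑-▸ (incr u) l _)) (∑-incr (suc j) (G l d))) ⟩
    + ((suc j + l) C suc j) ℤ.* G l d ∎
    where
    open ≡-Reasoning
    h : Word → Word → ℤ
    h u v = incr u ▸ start long 0 (map suc v) d
    h-Invˡ : ∀ v → Inv (λ u → h u v)
    h-Invˡ v z iso = cong (_▸ start long 0 (map suc v) d) (incr-Inv z iso)
    h-Invʳ : ∀ u → Inv (h u)
    h-Invʳ u z iso = cong (incr u ▸_) (begin
      start long 0 (map suc (map proj₁ z)) d    ≡⟨ cong (λ v → start long 0 v d) (proj₁ (map-suc² z)) ⟨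
      start long 0 (map proj₁ (map suc² z)) d   ≡⟨ start-Iso (Iso-min z iso) long-length (here refl) (All.tabulate there) d ⟩
      start long 0 (map proj₂ (map suc² z)) d   ≡⟨ cong (λ v → start long 0 v d) (proj₂ (map-suc² z)) ⟩
      start long 0 (map suc (map proj₂ z)) d    ∎)
    point : ∀ w → length w ≡ suc j + l → insMin (extraWord d) w ≡ split (suc j) h w
    point (x ∷ w) |w| = trans (insMin-extra d x w) (cong₂ _▸_
      (trans (climbs≡incr j (suc x) (map suc w) (subst (j ≤_) (sym (trans (Lₚ.length-map suc w) (ℕₚ.suc-injective |w|))) (ℕₚ.m≤m+n j l)))
        (trans (cong (λ v → incr (suc x ∷ v)) (Lₚ.take-map j w)) (Inv-map-suc incr incr-Inv (x ∷ take j w))))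
      (cong (λ v → start long 0 v d) (Lₚ.drop-map j w)))

  ∑-extra : ∀ n d → ∑ (suc n) (extraWord d) ≡ + (n C suc j) ℤ.* G (n ∸ suc j) d
  ∑-extra n d with n ℕₚ.<? suc j
  -- The truncated index `n ∸ suc j` is meaningless here; the vanishing binomial coefficient removes
  -- it.
  ... | yes n<k = trans (∑-extra-< n d n<k) (sym (trans (cong (λ c → + c ℤ.* G (n ∸ suc j) d) (k>n⇒nCk≡0 n<k)) (ℤₚ.*-zeroˡ (G (n ∸ suc j) d))))
  ... | no n≮k = subst (λ m → ∑ (suc m) (extraWord d) ≡ + (m C suc j) ℤ.* G (n ∸ suc j) d)
                   (ℕₚ.m+[n∸m]≡n (ℕₚ.≮⇒≥ n≮k)) (∑-extra-+ (n ∸ suc j) d)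

  Q-suc : ∀ m n d → m ≢ j → Q (suc (suc m)) (suc n) d ≡ Q (suc m) n d
  Q-suc m n d m≢j = trans (∑-cong (suc n) (λ w |w| _ → point w |w|)) (∑-first (suc m) n d)
    where
    point : ∀ w → length w ≡ suc n → brick (exact (suc (suc m))) (0 ∷ []) (map suc w) d ≡ first (suc m) d (map suc w)
    point (x ∷ w) _ = trans (ℤₚ.+-identityˡ _) (brick-∷ʳ0 (suc m) (m≢j ∘ ℕₚ.suc-injective) (suc x) [] (map suc w) d)

  Q-k : ∀ n d → Q k (suc n) d ≡ Q (suc j) n d ℤ.+ + (n C suc j) ℤ.* G (n ∸ suc j) d
  Q-k n d = trans (∑-cong (suc n) (λ w |w| _ → point w |w|)) (trans (∑-+ (suc n) (λ w → first (suc j) d (map suc w)) (λ w → extraWord d (map suc w)))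
    (cong₂ ℤ._+_ (∑-first (suc j) n d) (trans (∑-ext (suc n) (Inv-map-suc (extraWord d) (extraWord-Inv d))) (∑-extra n d))))
    where
    point : ∀ w → length w ≡ suc n → brick (exact k) (0 ∷ []) (map suc w) d ≡ first (suc j) d (map suc w) ℤ.+ extraWord d (map suc w)
    point (x ∷ w) _ = trans (ℤₚ.+-identityˡ _) (brick-extra j (ℕₚ.+-identityʳ j) (one tt) w d)

  -- A first brick shorter than `k` never has the exceptional length, so its minima can be deleted
  -- one after another down to `Q-one`. This yields the first sum of the theorem.
  Q-U : ∀ i → i ≤ j → ∀ n d → Q (suc i) n d ≡ Uz k s (n ℤ.⊖ i) d
  Q-U zero _ n d = trans (Q-one n d) (sym (U≈F n d))
  Q-U (suc i) i<j zero d = refl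
  Q-U (suc i) i<j (suc n) d = trans (Q-suc i n d (ℕₚ.<⇒≢ i<j))
    (trans (Q-U i (ℕₚ.<⇒≤ i<j) n d) (cong (λ m → Uz k s m d) (sym (ℤₚ.[1+m]⊖[1+n]≡m⊖n n i))))

  -- The summand over p, at integer arguments

  summand : ℤ → Poly
  summand m = ((+ (1 + binomZ (m - + 2) (k ∸ 1))) ·ᴾ Uz k s (m - + k))
              +ᴾ (yᴾ *ᴾ ((+ binomZ (m - + 2) (k ∸ 1)) ·ᴾ Σᴾ[ 1 to k ∸ 1 ] (λ a → Uz k s (m - + k - + a))))

  -- Regrouped to match `Q-k`: the lone `u` comes from deleting `0`, and the bracket multiplied by
  -- the binomial coefficient is what `G-F` yields.
  summand-≡ : ∀ m c (u : Poly) (v : ℕ → Poly) → binomZ (m - + 2) (suc j) ≡ c → Uz k s (m - + k) ≡ u →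
    (∀ a → Uz k s (m - + k - + (1 + a)) ≡ v a) → ∀ d →
    summand m d ≡ u d ℤ.+ + c ℤ.* (u d ℤ.+ sh (λ d → sumℤ (map (λ a → v a d) (upTo (suc j)))) d)
  summand-≡ m c u v refl refl eqv d = trans
    (cong₂ ℤ._+_ (ℤₚ.*-distribʳ-+ (u d) (+ 1) (+ c)) (trans (yᴾ-* _ d)
      (trans (sh-cong (λ d → cong (ℤ._*_ (+ c)) (cong sumℤ (Lₚ.map-cong (λ a → cong (λ p → p d) (eqv a)) (upTo (suc j))))) d) (sh-* d))))
    (rearrange (u d) (+ c) (sh S d))
    where
    S : Poly
    S d = sumℤ (map (λ a → v a d) (upTo (suc j)))
    sh-* : sh (λ d → + c ℤ.* S d) ≈ᴾ (λ d → + c ℤ.* sh S d)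
    sh-* zero = sym (ℤₚ.*-zeroʳ (+ c))
    sh-* (suc d) = refl
    rearrange : ∀ u c t → + 1 ℤ.* u ℤ.+ c ℤ.* u ℤ.+ c ℤ.* t ≡ u ℤ.+ c ℤ.* (u ℤ.+ t)
    rearrange = solve-∀

  summand-zero : ∀ m → binomZ (m - + 2) (suc j) ≡ 0 → Uz k s (m - + k) ≡ 0ᴾ → ∀ d → summand m d ≡ + 0
  summand-zero m eqc equ d = trans (summand-≡ m 0 0ᴾ (λ a → Uz k s (m - + k - + (1 + a))) eqc equ (λ _ → refl) d)
    (trans (ℤₚ.+-identityˡ _) (ℤₚ.*-zeroˡ (+ 0 ℤ.+ sh (λ d → sumℤ (map (λ a → Uz k s (m - + k - + (1 + a)) d) (upTo (suc j)))) d)))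

  summand-Q : ∀ n d → summand (+ suc n) d ≡ Q k n d
  summand-Q zero d = summand-zero (+ 1) refl refl d
  summand-Q (suc n) d = begin
    summand (+ suc (suc n)) d
      ≡⟨ summand-≡ (+ suc (suc n)) (n C suc j) (Uz k s (n ℤ.⊖ j)) (λ a → Uz k s (n ℤ.⊖ j - + (1 + a))) refl
           (cong (Uz k s) shift) (λ a → cong (λ m → Uz k s (m - + (1 + a))) shift) d ⟩
    u ℤ.+ + (n C suc j) ℤ.* (u ℤ.+ t)
      ≡⟨ cong₂ ℤ._+_ (sym (Q-U j ℕₚ.≤-refl n d)) coefficient ⟩
    Q (suc j) n d ℤ.+ + (n C suc j) ℤ.* G (n ∸ suc j) d
      ≡⟨ Q-k n d ⟨
    Q k (suc n) d ∎
    where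
    open ≡-Reasoning
    u = Uz k s (n ℤ.⊖ j) d
    t = sh (λ d → sumℤ (map (λ a → Uz k s (n ℤ.⊖ j - + (1 + a)) d) (upTo (suc j)))) d
    shift : + suc (suc n) - + k ≡ n ℤ.⊖ j
    shift = trans (ℤₚ.[1+m]⊖[1+n]≡m⊖n (suc n) (suc j)) (ℤₚ.[1+m]⊖[1+n]≡m⊖n n j)
    coefficient : + (n C suc j) ℤ.* (u ℤ.+ t) ≡
                  + (n C suc j) ℤ.* G (n ∸ suc j) d
    coefficient with n ℕₚ.<? suc j
    ... | yes n<k rewrite k>n⇒nCk≡0 n<k = trans (ℤₚ.*-zeroˡ (u ℤ.+ t)) (sym (ℤₚ.*-zeroˡ (G (n ∸ suc j) d)))
    ... | no n≮k = cong (ℤ._*_ (+ (n C suc j))) (trans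
      (cong₂ ℤ._+_ (trans (cong (λ m → Uz k s m d) n⊖j) (U≈F (suc l) d))
        (sh-cong (λ d → sum-cong-< (suc j) λ { a (s≤s a≤j) → trans
            (cong (λ m → Uz k s m d) (trans (cong (_- + (1 + a)) n⊖j) (ℤₚ.[1+m]⊖[1+n]≡m⊖n l a)))
            (sym (Q-U a a≤j l d)) }) d))
      (sym (G-F l d)))
      where
      l = n ∸ suc j
      n⊖j : n ℤ.⊖ j ≡ + suc l
      n⊖j = trans (ℤₚ.⊖-≥ (ℕₚ.<⇒≤ (ℕₚ.≮⇒≥ n≮k))) (cong +_ (ℕₚ.+-∸-assoc 1 (ℕₚ.≮⇒≥ n≮k)))

  -- Deleting the minimum of a first brick longer than `k` lowers its length and the size of the
  -- permutation together, until the length is `k`.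
  summand-⊖ : ∀ p n d → summand (suc n ℤ.⊖ p) d ≡ Q (k + p) n d
  summand-⊖ zero n d = trans (summand-Q n d) (cong (λ m → Q m n d) (sym (ℕₚ.+-identityʳ k)))
  summand-⊖ (suc p) n d = trans (cong (λ m → summand m d) (ℤₚ.[1+m]⊖[1+n]≡m⊖n n p)) (pred n p)
    where
    pred : ∀ n p → summand (n ℤ.⊖ p) d ≡ Q (k + suc p) n d
    -- A single letter cannot fill the brick, and on the other side the index is at most 0, where
    -- the conventions make the summand vanish.
    pred zero zero = summand-zero (+ 0) refl refl d
    pred zero (suc p) = summand-zero (-[1+ p ]) refl refl d
    pred (suc n) p = trans (summand-⊖ p n d)
      (sym (trans (Q-suc (j + suc p) n d (ℕₚ.m+1+n≢m j)) (cong (λ m → Q (suc m) n d) (ℕₚ.+-suc j p))))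

  recurrence : ∀ n d → U k s (suc n) d ≡
    ℤ.- sh (Σᴾ[ 1 to k ∸ 1 ] (λ r → Uz k s (+ suc n - + r))) d ℤ.+ ℤ.- sh (Σᴾ[ 0 to s ∸ k ] (λ p → summand (+ suc n - + p))) d
  recurrence n zero = trans (U≈F (suc n) 0) (F-zero n)
  recurrence n (suc d) = trans (U≈F (suc n) (suc d)) (trans (F-Q n d) (trans
    (ℤₚ.neg-distrib-+ (sumℤ (map (λ i → Q (1 + i) n d) (upTo (suc j)))) _)
    (cong₂ (λ a b → ℤ.- a ℤ.+ ℤ.- b)
      (sum-cong-< (suc j) (λ { i (s≤s i≤j) → trans (Q-U i i≤j n d) (cong (λ m → Uz k s m d) (sym (ℤₚ.[1+m]⊖[1+n]≡m⊖n n i))) }))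
      (sum-cong-< (suc (s ∸ k)) (λ p _ → trans (sym (summand-⊖ p n d)) (cong (λ m → summand m d) (sym (ℤₚ.m-n≡m⊖n (suc n) p))))))))

  U₁ : U k s 1 ≈ᴾ (-ᴾ yᴾ)
  U₁ d = trans (U≈F 1 d) (value d)
    where
    0<s : 0 < s
    0<s = ℕₚ.≤-trans (s≤s z≤n) k≤s
    value : ∀ d → F 1 d ≡ ℤ.- yᴾ d
    value zero = refl
    value (suc zero) rewrite <ᵇ-true 0<s = refl
    value (suc (suc d)) rewrite <ᵇ-true 0<s = refl

theorem4 : (k1 s : ℕ) → 2 ≤ k1 → k1 ≤ s →
    (U k1 s 1 ≈ᴾ (-ᴾ yᴾ)) ×
    ((n : ℕ) → 2 ≤ n →
    U k1 s n ≈ᴾ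
    ((-ᴾ (yᴾ *ᴾ Σᴾ[ 1 to k1 ∸ 1 ] (λ r → Uz k1 s (+ n - + r))))
    +ᴾ (-ᴾ (yᴾ *ᴾ Σᴾ[ 0 to s ∸ k1 ] (λ p →
    ((+ (1 + binomZ (+ n - + p - + 2) (k1 ∸ 1))) ·ᴾ Uz k1 s (+ n - + p - + k1))
    +ᴾ (yᴾ *ᴾ ((+ binomZ (+ n - + p - + 2) (k1 ∸ 1))
    ·ᴾ Σᴾ[ 1 to k1 ∸ 1 ] (λ a → Uz k1 s (+ n - + p - + k1 - + a)))))))))
theorem4 (suc (suc j)) s (s≤s (s≤s z≤n)) k≤s = U₁ , λ { (suc n) _ d → trans (recurrence n d)
  (sym (cong₂ (λ a b → ℤ.- a ℤ.+ ℤ.- b)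
    (yᴾ-* (Σᴾ[ 1 to suc j ] (λ r → Uz k s (+ suc n - + r))) d)
    (yᴾ-* (Σᴾ[ 0 to s ∸ k ] (λ p → summand (+ suc n - + p))) d))) }
  where
  open Recurrence j s k≤s
  open Matches j s using (k)
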